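{- The theory $\mathsf{Seq}$ interprets the theory $\mathsf{Seq}^+$.
   Context: Language $\{e,\ \vdash,\ \circ\}$: $e$ constant, $\vdash$ and $\circ$ binary function symbols ($x\vdash y$ is a term, not provability; $x\circ y$ is also written $xy$). $\mathsf{Seq}$ has the axioms: $\mathsf{Seq}_1$: $\forall x y\, [x\vdash y\neq e]$; $\mathsf{Seq}_2$: $\forall x_1x_2y_1y_2\,[x_1\vdash x_2=y_1\vdash y_2\rightarrow (x_1=y_1\wedge x_2=y_2)]$; $\mathsf{Seq}_3$: $\forall x\,[x\circ e=x]$; $\mathsf{Seq}_4$: $\forall xyz\,[x\circ(y\vdash z)=(x\circ y)\vdash z]$; $\mathsf{Seq}_5$: $\forall x\,[x=e\vee\exists yz\,[x=y\vdash z]]$. $\mathsf{Seq}^+$ has the axioms $\mathsf{Seq}_1$–$\mathsf{Seq}_5$ together with $\mathsf{Seq}^*_3$: $\forall x\,[xe=x\wedge ex=x]$; $\mathsf{Seq}^*_5$: $\forall xyzw\,\big[xy=zw\leftrightarrow\exists u[(z=xu\wedge uw=y)\vee(x=zu\wedge uy=w)]\big]$; $\mathsf{Seq}^+_c$: $\forall xyz\,[(xy=xz\vee yx=zx)\rightarrow y=z]$. -}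

module Defs where

open import Data.Nat using (ℕ; zero; suc; _+_)
open import Data.Fin using (Fin; zero; suc; _↑ˡ_; _↑ʳ_; #_)
open import Data.Vec.Functional using (_∷_; _++_)
open import Data.Product using (Σ)

-- Syntax (de Bruijn: Term n / Fm n have n free variables, var zero is
-- the most recently bound one)

infixl 8 _∘ₜ_
infixl 7 _⊢ₜ_

data Term (n : ℕ) : Set where
  var   : Fin n → Term n
  ε     : Term n
  _⊢ₜ_  : Term n → Term n → Term n
  _∘ₜ_  : Term n → Term n → Term n

infix 5 _≐_
infixr 2 _⇒_

data Fm (n : ℕ) : Set where
  ⊥'  : Fm n
  _≐_ : Term n → Term n → Fm n
  _⇒_ : Fm n → Fm n → Fm n
  ∀'  : Fm (suc n) → Fm n

infixr 4 _∧'_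
infixr 3 _∨'_
infix 1 _⇔_

¬' : ∀ {n} → Fm n → Fm n
¬' φ = φ ⇒ ⊥'

_∧'_ : ∀ {n} → Fm n → Fm n → Fm n
φ ∧' ψ = ¬' (φ ⇒ ¬' ψ)

_∨'_ : ∀ {n} → Fm n → Fm n → Fm n
φ ∨' ψ = ¬' φ ⇒ ψ

_⇔_ : ∀ {n} → Fm n → Fm n → Fm n
φ ⇔ ψ = (φ ⇒ ψ) ∧' (ψ ⇒ φ)

∃' : ∀ {n} → Fm (suc n) → Fm n
∃' φ = ¬' (∀' (¬' φ))

liftRen : ∀ {n m} → (Fin n → Fin m) → Fin (suc n) → Fin (suc m)
liftRen ρ zero    = zero
liftRen ρ (suc i) = suc (ρ i)

renT : ∀ {n m} → (Fin n → Fin m) → Term n → Term m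
renT ρ (var i)  = var (ρ i)
renT ρ ε        = ε
renT ρ (s ⊢ₜ t) = renT ρ s ⊢ₜ renT ρ t
renT ρ (s ∘ₜ t) = renT ρ s ∘ₜ renT ρ t

renF : ∀ {n m} → (Fin n → Fin m) → Fm n → Fm m
renF ρ ⊥'      = ⊥'
renF ρ (s ≐ t) = renT ρ s ≐ renT ρ t
renF ρ (φ ⇒ ψ) = renF ρ φ ⇒ renF ρ ψ
renF ρ (∀' φ)  = ∀' (renF (liftRen ρ) φ)

liftSub : ∀ {n m} → (Fin n → Term m) → Fin (suc n) → Term (suc m)
liftSub σ zero    = var zero
liftSub σ (suc i) = renT suc (σ i)

subT : ∀ {n m} → (Fin n → Term m) → Term n → Term m
subT σ (var i)  = σ i
subT σ ε        = ε
subT σ (s ⊢ₜ t) = subT σ s ⊢ₜ subT σ t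
subT σ (s ∘ₜ t) = subT σ s ∘ₜ subT σ t

subF : ∀ {n m} → (Fin n → Term m) → Fm n → Fm m
subF σ ⊥'      = ⊥'
subF σ (s ≐ t) = subT σ s ≐ subT σ t
subF σ (φ ⇒ ψ) = subF σ φ ⇒ subF σ ψ
subF σ (∀' φ)  = ∀' (subF (liftSub σ) φ)

_[_] : ∀ {n} → Fm (suc n) → Term n → Fm n
φ [ t ] = subF (t ∷ var) φ

wk : ∀ {n} → Fm n → Fm (suc n)
wk = renF suc

wkSentence : ∀ {n} → Fm 0 → Fm n
wkSentence = renF (λ ())

∀ⁿ : ∀ k {m} → Fm (k + m) → Fm m
∀ⁿ zero    φ = φ
∀ⁿ (suc k) φ = ∀ⁿ k (∀' φ)

∃ⁿ : ∀ k {m} → Fm (k + m) → Fm m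
∃ⁿ zero    φ = φ
∃ⁿ (suc k) φ = ∃ⁿ k (∃' φ)

∀* : ∀ {p} → Fm p → Fm 0
∀* {zero}  φ = φ
∀* {suc p} φ = ∀* (∀' φ)

∃* : ∀ {p} → Fm p → Fm 0
∃* {zero}  φ = φ
∃* {suc p} φ = ∃* (∃' φ)

Theory : Set₁
Theory = Fm 0 → Set

data Prf (T : Theory) : ∀ {n} → Fm n → Set where
  axiom : ∀ {n} {A : Fm 0} → T A → Prf T {n} (wkSentence A)
  K     : ∀ {n} {φ ψ : Fm n} → Prf T (φ ⇒ ψ ⇒ φ)
  S     : ∀ {n} {φ ψ χ : Fm n} → Prf T ((φ ⇒ ψ ⇒ χ) ⇒ (φ ⇒ ψ) ⇒ φ ⇒ χ)
  DNE   : ∀ {n} {φ : Fm n} → Prf T (¬' (¬' φ) ⇒ φ)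
  MP    : ∀ {n} {φ ψ : Fm n} → Prf T (φ ⇒ ψ) → Prf T φ → Prf T ψ
  Gen   : ∀ {n} {φ : Fm (suc n)} → Prf T φ → Prf T (∀' φ)
  Inst  : ∀ {n} {φ : Fm (suc n)} (t : Term n) → Prf T (∀' φ ⇒ φ [ t ])
  ∀Dist : ∀ {n} {φ : Fm n} {ψ : Fm (suc n)} →
          Prf T (∀' (wk φ ⇒ ψ) ⇒ φ ⇒ ∀' ψ)
  Refl  : ∀ {n} (t : Term n) → Prf T (t ≐ t)
  Leib  : ∀ {n} (φ : Fm (suc n)) (s t : Term n) →
          Prf T (s ≐ t ⇒ φ [ s ] ⇒ φ [ t ])

data Seq : Theory where
  seq₁ : Seq (∀' (∀' (¬' ((var (# 1) ⊢ₜ var (# 0)) ≐ ε))))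
  seq₂ : Seq (∀' (∀' (∀' (∀' (((var (# 3) ⊢ₜ var (# 2)) ≐ (var (# 1) ⊢ₜ var (# 0)))
               ⇒ ((var (# 3) ≐ var (# 1)) ∧' (var (# 2) ≐ var (# 0))))))))
  seq₃ : Seq (∀' ((var (# 0) ∘ₜ ε) ≐ var (# 0)))
  seq₄ : Seq (∀' (∀' (∀' ((var (# 2) ∘ₜ (var (# 1) ⊢ₜ var (# 0)))
               ≐ ((var (# 2) ∘ₜ var (# 1)) ⊢ₜ var (# 0))))))
  seq₅ : Seq (∀' ((var (# 0) ≐ ε)
               ∨' ∃' (∃' (var (# 2) ≐ (var (# 1) ⊢ₜ var (# 0))))))

data Seq⁺ : Theory where
  base  : ∀ {A} → Seq A → Seq⁺ A
  seq*₃ : Seq⁺ (∀' (((var (# 0) ∘ₜ ε) ≐ var (# 0)) ∧' ((ε ∘ₜ var (# 0)) ≐ var (# 0))))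
  seq*₅ : Seq⁺ (∀' (∀' (∀' (∀' (((var (# 3) ∘ₜ var (# 2)) ≐ (var (# 1) ∘ₜ var (# 0)))
               ⇔ ∃' (((var (# 2) ≐ (var (# 4) ∘ₜ var (# 0)))
                        ∧' ((var (# 0) ∘ₜ var (# 1)) ≐ var (# 3)))
                     ∨' ((var (# 4) ≐ (var (# 2) ∘ₜ var (# 0)))
                        ∧' ((var (# 0) ∘ₜ var (# 3)) ≐ var (# 1)))))))))
  seq⁺c : Seq⁺ (∀' (∀' (∀' ((((var (# 2) ∘ₜ var (# 1)) ≐ (var (# 2) ∘ₜ var (# 0)))
               ∨' ((var (# 1) ∘ₜ var (# 2)) ≐ (var (# 0) ∘ₜ var (# 2))))
               ⇒ (var (# 1) ≐ var (# 0))))))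

-- Interpretations (multi-dimensional, with parameters; the target
-- equality and the function symbols are translated by formulas, i.e.
-- function symbols are translated relationally via their graphs).

record Translation : Set where
  field
    dim-1 : ℕ
    p     : ℕ                  -- number of parameters
  d : ℕ
  d = suc dim-1
  field
    α     : Fm p                          -- parameter domain α(π)
    δ     : Fm (d + p)                    -- domain δ(x, π)
    eqv   : Fm (d + (d + p))
    e-gr  : Fm (d + p)
    ⊢-gr  : Fm (d + (d + (d + p)))
    ∘-gr  : Fm (d + (d + (d + p)))

  Tup : ℕ → Set
  Tup m = Fin d → Fin m

  Par : ℕ → Set
  Par m = Fin p → Fin m

  δ⟨_⟩ : ∀ {m} → Tup m → Par m → Fm m
  δ⟨ x ⟩ π = renF (x ++ π) δ

  E⟨_,_⟩ : ∀ {m} → Tup m → Tup m → Par m → Fm m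
  E⟨ x , y ⟩ π = renF (x ++ (y ++ π)) eqv

  e⟨_⟩ : ∀ {m} → Tup m → Par m → Fm m
  e⟨ x ⟩ π = renF (x ++ π) e-gr

  ⊢⟨_,_,_⟩ : ∀ {m} → Tup m → Tup m → Tup m → Par m → Fm m
  ⊢⟨ x , y , z ⟩ π = renF (x ++ (y ++ (z ++ π))) ⊢-gr

  ∘⟨_,_,_⟩ : ∀ {m} → Tup m → Tup m → Tup m → Par m → Fm m
  ∘⟨ x , y , z ⟩ π = renF (x ++ (y ++ (z ++ π))) ∘-gr

  new : ∀ {m} → Tup (d + m)
  new {m} j = j ↑ˡ m

  up : ∀ {m} → Fin m → Fin (d + m)
  up i = d ↑ʳ i

  ∀δ : ∀ {m} → Par m → Fm (d + m) → Fm m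
  ∀δ π φ = ∀ⁿ d (δ⟨ new ⟩ (λ i → up (π i)) ⇒ φ)

  ∃δ : ∀ {m} → Par m → Fm (d + m) → Fm m
  ∃δ π φ = ∃ⁿ d (δ⟨ new ⟩ (λ i → up (π i)) ∧' φ)

  -- ⟦ t ⟧ ρ π x : "the value of t under the assignment ρ is (E-equal to) x"
  ⟦_⟧ : ∀ {n m} → Term n → (Fin n → Tup m) → Par m → Tup m → Fm m
  ⟦ var i  ⟧ ρ π x = E⟨ ρ i , x ⟩ π
  ⟦ ε      ⟧ ρ π x = e⟨ x ⟩ π
  ⟦ s ⊢ₜ t ⟧ ρ π x =
    ∃δ π (∃δ (λ i → up (π i))
      (⟦ s ⟧ (λ i j → up (up (ρ i j))) (λ i → up (up (π i))) (λ j → up (new j))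
       ∧' ⟦ t ⟧ (λ i j → up (up (ρ i j))) (λ i → up (up (π i))) new
       ∧' ⊢⟨ (λ j → up (new j)) , new , (λ j → up (up (x j))) ⟩ (λ i → up (up (π i)))))
  ⟦ s ∘ₜ t ⟧ ρ π x =
    ∃δ π (∃δ (λ i → up (π i))
      (⟦ s ⟧ (λ i j → up (up (ρ i j))) (λ i → up (up (π i))) (λ j → up (new j))
       ∧' ⟦ t ⟧ (λ i j → up (up (ρ i j))) (λ i → up (up (π i))) new
       ∧' ∘⟨ (λ j → up (new j)) , new , (λ j → up (up (x j))) ⟩ (λ i → up (up (π i)))))

  tr : ∀ {n m} → Fm n → (Fin n → Tup m) → Par m → Fm m
  tr ⊥'      ρ π = ⊥'
  tr (s ≐ t) ρ π =
    ∃δ π (∃δ (λ i → up (π i))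
      (⟦ s ⟧ (λ i j → up (up (ρ i j))) (λ i → up (up (π i))) (λ j → up (new j))
       ∧' ⟦ t ⟧ (λ i j → up (up (ρ i j))) (λ i → up (up (π i))) new
       ∧' E⟨ (λ j → up (new j)) , new ⟩ (λ i → up (up (π i)))))
  tr (φ ⇒ ψ) ρ π = tr φ ρ π ⇒ tr ψ ρ π
  tr (∀' φ)  ρ π = ∀δ π (tr φ (new ∷ (λ i j → up (ρ i j))) (λ i → up (π i)))

  tr₀ : Fm 0 → Fm p
  tr₀ A = tr A (λ ()) (λ i → i)

record IsInterpretation (K : Translation) (U V : Theory) : Set where
  open Translation K
  field
    params-exist : Prf V (∃* α)
    preserves    : (A : Fm 0) → Prf U A → Prf V (∀* (α ⇒ tr₀ A))

_Interprets_ : Theory → Theory → Set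
V Interprets U = Σ Translation (λ K → IsInterpretation K U V)

{-# OPTIONS --safe #-}
module Submission where

-- Relativise to the definable class Good of those x for which e ∘ x = x,
-- associativity, right cancellation, the editor axiom and "y ∘ u = y implies
-- u = e" for prefixes y of x are available; it contains e and the singletons,
-- is closed under ∘, and y ⊢ a lies in it iff y does.  The only obstacle is that
-- the entry a need not lie in Good.  A definable Hilbert-hotel bijection from the
-- universe onto Good repairs this: x ⊢ y is interpreted as x ⊢ v, where v is the
-- element sent to y.
--
-- Derivations in Seq are obtained through Kripke forcing over finite sets of
-- hypotheses, with the terms in countably many names as constant domain; forcing
-- of a formula without ∨ and ∃ is the same as derivability, so a proof written
-- with Agda functions over all terms can be read back as a Hilbert derivation.

open import Defs
open import Data.Nat using (ℕ; zero; suc; _⊔_; _∸_; _≤_)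
open import Data.Nat.Properties using (_≟_; <-irrefl; ≤-trans; m≤m⊔n; m≤n⊔m)
open import Data.Fin using (Fin; zero; suc; #_)
open import Data.Vec.Functional using (_∷_; [])
open import Data.List using (List; map; drop; length) renaming ([] to []ₗ; _∷_ to infixr 1 _∷ₗ_)
open import Data.List.Relation.Unary.All as All using (All) renaming ([] to []ₐ; _∷_ to _∷ₐ_)
open import Data.List.Relation.Unary.All.Properties using (drop⁺)
open import Data.Product using (_×_; _,_; proj₁; proj₂)
open import Function using (_∘_; id; case_of_)
open import Relation.Nullary using (yes; no; contradiction)
open import Relation.Binary.PropositionalEquality
  using (_≡_; refl; sym; trans; cong; cong₂; subst; module ≡-Reasoning)

-- Substitution

module _ {n m : ℕ} {σ τ : Fin n → Term m} where
  subT-cong : (∀ i → σ i ≡ τ i) → ∀ t → subT σ t ≡ subT τ t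
  subT-cong h (var i)  = h i
  subT-cong h ε        = refl
  subT-cong h (s ⊢ₜ t) = cong₂ _⊢ₜ_ (subT-cong h s) (subT-cong h t)
  subT-cong h (s ∘ₜ t) = cong₂ _∘ₜ_ (subT-cong h s) (subT-cong h t)

  liftSub-cong : (∀ i → σ i ≡ τ i) → ∀ i → liftSub σ i ≡ liftSub τ i
  liftSub-cong h zero    = refl
  liftSub-cong h (suc i) = cong (renT suc) (h i)

subF-cong : ∀ {n m} {σ τ : Fin n → Term m} → (∀ i → σ i ≡ τ i) → ∀ φ → subF σ φ ≡ subF τ φ
subF-cong h ⊥'      = refl
subF-cong h (s ≐ t) = cong₂ _≐_ (subT-cong h s) (subT-cong h t)
subF-cong h (φ ⇒ ψ) = cong₂ _⇒_ (subF-cong h φ) (subF-cong h ψ)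
subF-cong h (∀' φ)  = cong ∀' (subF-cong (liftSub-cong h) φ)

renT≡subT : ∀ {n m} (ρ : Fin n → Fin m) t → renT ρ t ≡ subT (var ∘ ρ) t
renT≡subT ρ (var i)  = refl
renT≡subT ρ ε        = refl
renT≡subT ρ (s ⊢ₜ t) = cong₂ _⊢ₜ_ (renT≡subT ρ s) (renT≡subT ρ t)
renT≡subT ρ (s ∘ₜ t) = cong₂ _∘ₜ_ (renT≡subT ρ s) (renT≡subT ρ t)

renF≡subF : ∀ {n m} (ρ : Fin n → Fin m) φ → renF ρ φ ≡ subF (var ∘ ρ) φ
renF≡subF ρ ⊥'      = refl
renF≡subF ρ (s ≐ t) = cong₂ _≐_ (renT≡subT ρ s) (renT≡subT ρ t)
renF≡subF ρ (φ ⇒ ψ) = cong₂ _⇒_ (renF≡subF ρ φ) (renF≡subF ρ ψ)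
renF≡subF ρ (∀' φ)  = cong ∀' (trans (renF≡subF (liftRen ρ) φ)
  (subF-cong (λ { zero → refl ; (suc i) → refl }) φ))

subT-∘ : ∀ {n m k} (σ : Fin m → Term k) (τ : Fin n → Term m) t →
         subT σ (subT τ t) ≡ subT (subT σ ∘ τ) t
subT-∘ σ τ (var i)  = refl
subT-∘ σ τ ε        = refl
subT-∘ σ τ (s ⊢ₜ t) = cong₂ _⊢ₜ_ (subT-∘ σ τ s) (subT-∘ σ τ t)
subT-∘ σ τ (s ∘ₜ t) = cong₂ _∘ₜ_ (subT-∘ σ τ s) (subT-∘ σ τ t)

subT-renT : ∀ {n m k} (σ : Fin m → Term k) (ρ : Fin n → Fin m) t →
            subT σ (renT ρ t) ≡ subT (σ ∘ ρ) t
subT-renT σ ρ t = trans (cong (subT σ) (renT≡subT ρ t)) (subT-∘ σ (var ∘ ρ) t)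

subT-liftSub : ∀ {n m} (σ : Fin n → Term m) t →
               subT (liftSub σ) (renT suc t) ≡ renT suc (subT σ t)
subT-liftSub σ t = begin
  subT (liftSub σ) (renT suc t)  ≡⟨ subT-renT (liftSub σ) suc t ⟩
  subT (renT suc ∘ σ) t          ≡⟨ subT-cong (λ i → renT≡subT suc (σ i)) t ⟩
  subT (subT (var ∘ suc) ∘ σ) t  ≡⟨ subT-∘ (var ∘ suc) σ t ⟨
  subT (var ∘ suc) (subT σ t)    ≡⟨ renT≡subT suc (subT σ t) ⟨
  renT suc (subT σ t)            ∎
  where open ≡-Reasoning

subF-∘ : ∀ {n m k} (σ : Fin m → Term k) (τ : Fin n → Term m) φ →
         subF σ (subF τ φ) ≡ subF (subT σ ∘ τ) φ
subF-∘ σ τ ⊥'      = refl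
subF-∘ σ τ (s ≐ t) = cong₂ _≐_ (subT-∘ σ τ s) (subT-∘ σ τ t)
subF-∘ σ τ (φ ⇒ ψ) = cong₂ _⇒_ (subF-∘ σ τ φ) (subF-∘ σ τ ψ)
subF-∘ σ τ (∀' φ)  = cong ∀' (trans (subF-∘ (liftSub σ) (liftSub τ) φ)
  (subF-cong (λ { zero → refl ; (suc i) → subT-liftSub σ (τ i) }) φ))

subT-id : ∀ {n} (t : Term n) → subT var t ≡ t
subT-id (var i)  = refl
subT-id ε        = refl
subT-id (s ⊢ₜ t) = cong₂ _⊢ₜ_ (subT-id s) (subT-id t)
subT-id (s ∘ₜ t) = cong₂ _∘ₜ_ (subT-id s) (subT-id t)

subF-id : ∀ {n} (φ : Fm n) → subF var φ ≡ φ
subF-id ⊥'      = refl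
subF-id (s ≐ t) = cong₂ _≐_ (subT-id s) (subT-id t)
subF-id (φ ⇒ ψ) = cong₂ _⇒_ (subF-id φ) (subF-id ψ)
subF-id (∀' φ)  = cong ∀' (trans
  (subF-cong (λ { zero → refl ; (suc i) → refl }) φ) (subF-id φ))

instT-wk : ∀ {n} (s t : Term n) → subT (s ∷ var) (renT suc t) ≡ t
instT-wk s t = trans (subT-renT (s ∷ var) suc t) (subT-id t)

subF-[] : ∀ {n m} (t : Term m) (τ : Fin n → Term m) φ →
          subF (liftSub τ) φ [ t ] ≡ subF (t ∷ τ) φ
subF-[] t τ φ = trans (subF-∘ (t ∷ var) (liftSub τ) φ)
  (subF-cong (λ { zero → refl ; (suc i) → instT-wk t (τ i) }) φ)

wk-subF : ∀ {n m} (τ : Fin n → Term m) φ → wk (subF τ φ) ≡ subF (renT suc ∘ τ) φ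
wk-subF τ φ = begin
  wk (subF τ φ)                  ≡⟨ renF≡subF suc (subF τ φ) ⟩
  subF (var ∘ suc) (subF τ φ)    ≡⟨ subF-∘ (var ∘ suc) τ φ ⟩
  subF (subT (var ∘ suc) ∘ τ) φ  ≡⟨ subF-cong (λ i → renT≡subT suc (τ i)) φ ⟨
  subF (renT suc ∘ τ) φ          ∎
  where open ≡-Reasoning

-- Kripke forcing over a constant domain of terms in countably many names

infixl 7 _▷_
infixl 8 _∙_

data Tm : Set where
  name    : ℕ → Tm
  e       : Tm
  _▷_ _∙_ : Tm → Tm → Tm

inst : ∀ {n} → (ℕ → Term n) → Tm → Term n
inst σ (name k) = σ k
inst σ e        = ε
inst σ (s ▷ t)  = inst σ s ⊢ₜ inst σ t
inst σ (s ∙ t)  = inst σ s ∘ₜ inst σ t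

-- One more than the largest name that occurs, so `bound t ≤ k` says that `name k` is fresh for `t`.
bound : Tm → ℕ
bound (name k) = suc k
bound e        = 0
bound (s ▷ t)  = bound s ⊔ bound t
bound (s ∙ t)  = bound s ⊔ bound t

boundEnv : ∀ {k} → (Fin k → Tm) → ℕ
boundEnv {zero}  ρ = 0
boundEnv {suc k} ρ = bound (ρ zero) ⊔ boundEnv (ρ ∘ suc)

bound≤boundEnv : ∀ {k} (ρ : Fin k → Tm) i → bound (ρ i) ≤ boundEnv ρ
bound≤boundEnv ρ zero    = m≤m⊔n _ _
bound≤boundEnv ρ (suc i) = ≤-trans (bound≤boundEnv (ρ ∘ suc) i) (m≤n⊔m _ _)

-- Turns the name `k` into the newly bound variable. A name that is fresh for the hypotheses thus
-- plays the part of an eigenvariable.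
bindName : ∀ {n} → ℕ → (ℕ → Term n) → ℕ → Term (suc n)
bindName k σ j = case j ≟ k of λ where
  (yes _) → var zero
  (no _)  → renT suc (σ j)

bindName-bound : ∀ {n} k (σ : ℕ → Term n) → bindName k σ k ≡ var zero
bindName-bound k σ with k ≟ k
... | yes _  = refl
... | no k≢k = contradiction refl k≢k

bindName-fresh : ∀ {n} k (σ : ℕ → Term n) t → bound t ≤ k →
                 inst (bindName k σ) t ≡ renT suc (inst σ t)
bindName-fresh k σ (name j) j<k with j ≟ k
... | yes j≡k = contradiction j<k (<-irrefl j≡k)
... | no _    = refl
bindName-fresh k σ e       _ = refl
bindName-fresh k σ (s ▷ t) h = cong₂ _⊢ₜ_
  (bindName-fresh k σ s (≤-trans (m≤m⊔n _ _) h)) (bindName-fresh k σ t (≤-trans (m≤n⊔m _ _) h))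
bindName-fresh k σ (s ∙ t) h = cong₂ _∘ₜ_
  (bindName-fresh k σ s (≤-trans (m≤m⊔n _ _) h)) (bindName-fresh k σ t (≤-trans (m≤n⊔m _ _) h))

infixr 2 _⊃_
infix  5 _≈_
infixr 4 _∧_
infixr 3 _∨_

-- The quantifier takes an Agda function on terms, so statements about Seq can be instantiated
-- without any substitution lemma.
data Pr : Set where
  ⊥ᵖ  : Pr
  _≈_ : Tm → Tm → Pr
  _⊃_ : Pr → Pr → Pr
  Π   : (Tm → Pr) → Pr

¬_ : Pr → Pr
¬ A = A ⊃ ⊥ᵖ

_∧_ _∨_ : Pr → Pr → Pr
A ∧ B = ¬ (A ⊃ ¬ B)
A ∨ B = ¬ A ⊃ B

Ex : (Tm → Pr) → Pr
Ex F = ¬ Π λ x → ¬ F x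

eval : ∀ {n} → (Fin n → Tm) → Term n → Tm
eval ρ (var i)  = ρ i
eval ρ ε        = e
eval ρ (s ⊢ₜ t) = eval ρ s ▷ eval ρ t
eval ρ (s ∘ₜ t) = eval ρ s ∙ eval ρ t

⟪_⟫ : ∀ {n} → Fm n → (Fin n → Tm) → Pr
⟪ ⊥' ⟫ ρ    = ⊥ᵖ
⟪ s ≐ t ⟫ ρ = eval ρ s ≈ eval ρ t
⟪ φ ⇒ ψ ⟫ ρ = ⟪ φ ⟫ ρ ⊃ ⟪ ψ ⟫ ρ
⟪ ∀' φ ⟫ ρ  = Π λ x → ⟪ φ ⟫ (x ∷ ρ)

inst-eval : ∀ {n k} (σ : ℕ → Term n) (ρ : Fin k → Tm) t →
            inst σ (eval ρ t) ≡ subT (inst σ ∘ ρ) t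
inst-eval σ ρ (var i)  = refl
inst-eval σ ρ ε        = refl
inst-eval σ ρ (s ⊢ₜ t) = cong₂ _⊢ₜ_ (inst-eval σ ρ s) (inst-eval σ ρ t)
inst-eval σ ρ (s ∘ₜ t) = cong₂ _∘ₜ_ (inst-eval σ ρ s) (inst-eval σ ρ t)

infixr 0 _⇛_

-- The head of the list becomes the innermost antecedent, so discharging the latest hypothesis holds
-- by definition.
_⇛_ : ∀ {n} → List (Fm n) → Fm n → Fm n
[]ₗ      ⇛ φ = φ
(ψ ∷ₗ Γ) ⇛ φ = Γ ⇛ (ψ ⇒ φ)

record Closure : Set where
  constructor closure
  field
    {arity} : ℕ
    body    : Fm arity
    env     : Fin arity → Tm

World : Set
World = List Closure

close : ∀ {n} → (ℕ → Term n) → Closure → Fm n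
close σ (closure φ ρ) = subF (inst σ ∘ ρ) φ

boundW : World → ℕ
boundW []ₗ                = 0
boundW (closure φ ρ ∷ₗ w) = boundEnv ρ ⊔ boundW w

-- Γ ⊑ Δ computes to a reflexivity when Γ and Δ have explicit spines, so that
-- instance search finds all weakenings between such contexts.
infix 0 _⊑_

_⊑_ : List Pr → List Pr → Set
Γ ⊑ Δ = drop (length Δ ∸ length Γ) Δ ≡ Γ

module Forcing (T : Theory) where

  pure : ∀ {n} Γ {φ : Fm n} → Prf T φ → Prf T (Γ ⇛ φ)
  pure []ₗ      p = p
  pure (ψ ∷ₗ Γ) p = pure Γ (MP K p)

  app : ∀ {n} Γ {φ ψ : Fm n} → Prf T (Γ ⇛ (φ ⇒ ψ)) → Prf T (Γ ⇛ φ) → Prf T (Γ ⇛ ψ)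
  app []ₗ      p q = MP p q
  app (χ ∷ₗ Γ) p q = app Γ (app Γ (pure Γ S) p) q

  gen : ∀ {n} Γ {φ : Fm (suc n)} → Prf T (map wk Γ ⇛ φ) → Prf T (Γ ⇛ ∀' φ)
  gen []ₗ      p = Gen p
  gen (ψ ∷ₗ Γ) p = app Γ (pure Γ ∀Dist) (gen Γ p)

  head : ∀ {n} Γ {φ : Fm n} → Prf T (φ ∷ₗ Γ ⇛ φ)
  head Γ {φ} = pure Γ (MP (MP S K) (K {ψ = φ}))

  -- Derivability is required uniformly in the instantiation of the names; generalisation over a
  -- name depends on this freedom.
  Der : World → (∀ {n} → (ℕ → Term n) → Fm n) → Set
  Der w φ = ∀ {n} (σ : ℕ → Term n) → Prf T (map (close σ) w ⇛ φ σ)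

  infix 0 _⊆ʷ_
  -- An extension is any world to which derivations carry over, so that extensions compose as
  -- functions do.
  record _⊆ʷ_ (w v : World) : Set where
    constructor extends
    field
      weaken : ∀ {n} (σ : ℕ → Term n) {φ} →
               Prf T (map (close σ) w ⇛ φ) → Prf T (map (close σ) v ⇛ φ)
  open _⊆ʷ_

  infix 0 _⊩_
  _⊩_ : World → Pr → Set
  w ⊩ ⊥ᵖ    = Der w λ σ → ⊥'
  w ⊩ s ≈ t = Der w λ σ → inst σ s ≐ inst σ t
  w ⊩ A ⊃ B = ∀ {v} → w ⊆ʷ v → v ⊩ A → v ⊩ B
  w ⊩ Π F   = ∀ x → w ⊩ F x

  mono : ∀ A {w v} → w ⊆ʷ v → w ⊩ A → v ⊩ A
  mono ⊥ᵖ      w⊆v h   = λ σ → weaken w⊆v σ (h σ)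
  mono (s ≈ t) w⊆v h   = λ σ → weaken w⊆v σ (h σ)
  mono (A ⊃ B) w⊆v h   = λ v⊆u → h (extends λ σ p → weaken v⊆u σ (weaken w⊆v σ p))
  mono (Π F)   w⊆v h x = mono (F x) w⊆v (h x)

  ⊆ʷ-refl : ∀ {w} → w ⊆ʷ w
  ⊆ʷ-refl = extends λ _ p → p

  ⊆ʷ-step : ∀ {w} c → w ⊆ʷ c ∷ₗ w
  ⊆ʷ-step {w} c = extends λ σ p → app (map (close σ) w) (pure (map (close σ) w) K) p

  DerC : World → Closure → Set
  DerC w c = Der w λ σ → close σ c

  map-close-fresh : ∀ {n} k (σ : ℕ → Term n) w → boundW w ≤ k →
                    map (close (bindName k σ)) w ≡ map wk (map (close σ) w)
  map-close-fresh k σ []ₗ                h = refl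
  map-close-fresh k σ (closure φ ρ ∷ₗ w) h = cong₂ _∷ₗ_
    (trans (subF-cong (λ i → bindName-fresh k σ (ρ i)
              (≤-trans (bound≤boundEnv ρ i) (≤-trans (m≤m⊔n _ _) h))) φ)
           (sym (wk-subF _ φ)))
    (map-close-fresh k σ w (≤-trans (m≤n⊔m _ _) h))

  -- A name above all those in `w` and `ρ` is bound to variable zero. The hypotheses then become
  -- weakenings, and `Gen` applies.
  generalise : ∀ w {k} (φ : Fm (suc k)) ρ →
               (∀ x → DerC w (closure φ (x ∷ ρ))) → DerC w (closure (∀' φ) ρ)
  generalise w φ ρ d σ = gen (map (close σ) w)
    (subst (Prf T) (cong₂ _⇛_ (map-close-fresh j σ w (m≤m⊔n _ _)) (subF-cong body≡ φ))
      (d (name j) (bindName j σ)))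
    where
    j : ℕ
    j = boundW w ⊔ boundEnv ρ
    body≡ : ∀ i → inst (bindName j σ) ((name j ∷ ρ) i) ≡ liftSub (inst σ ∘ ρ) i
    body≡ zero    = bindName-bound j σ
    body≡ (suc i) = bindName-fresh j σ (ρ i)
      (≤-trans (bound≤boundEnv ρ i) (m≤n⊔m (boundW w) _))

  -- Both directions go by simultaneous induction, since an implication swaps them: to reify it, the
  -- world is extended by the antecedent, which is reflected there. The quantifier over all terms is
  -- read back at a fresh name.
  reify   : ∀ {k} (φ : Fm k) ρ {w} → w ⊩ ⟪ φ ⟫ ρ → DerC w (closure φ ρ)
  reflect : ∀ {k} (φ : Fm k) ρ {w} → DerC w (closure φ ρ) → w ⊩ ⟪ φ ⟫ ρ

  reify ⊥'      ρ h = h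
  reify (s ≐ t) ρ {w} h σ = subst (λ χ → Prf T (map (close σ) w ⇛ χ))
    (cong₂ _≐_ (inst-eval σ ρ s) (inst-eval σ ρ t)) (h σ)
  reify (φ ⇒ ψ) ρ {w} h = reify ψ ρ (h (⊆ʷ-step (closure φ ρ))
    (reflect φ ρ (λ σ → head (map (close σ) w))))
  reify (∀' φ)  ρ {w} h = generalise w φ ρ (λ x → reify φ (x ∷ ρ) (h x))

  reflect ⊥'      ρ d = d
  reflect (s ≐ t) ρ {w} d σ = subst (λ χ → Prf T (map (close σ) w ⇛ χ))
    (sym (cong₂ _≐_ (inst-eval σ ρ s) (inst-eval σ ρ t))) (d σ)
  reflect (φ ⇒ ψ) ρ d {v} w⊆v h =
    reflect ψ ρ (λ σ → app (map (close σ) v) (weaken w⊆v σ (d σ)) (reify φ ρ h σ))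
  reflect (∀' φ)  ρ {w} d x = reflect φ (x ∷ ρ) λ σ →
    subst (λ χ → Prf T (map (close σ) w ⇛ χ))
      (trans (subF-[] (inst σ x) (inst σ ∘ ρ) φ)
             (subF-cong (λ { zero → refl ; (suc i) → refl }) φ))
      (app (map (close σ) w) (pure (map (close σ) w) (Inst (inst σ x))) (d σ))

  -- Without ∨ and ∃ among the primitives, stability passes through every connective down to
  -- equations, where the object-level `DNE` supplies it.
  ⊩-stable : ∀ A {w} → w ⊩ ¬ ¬ A → w ⊩ A
  ⊩-stable ⊥ᵖ      h = h ⊆ʷ-refl (λ _ p → p)
  ⊩-stable (s ≈ t) {w} h = λ σ → let Δ = map (close σ) w in
    app Δ (pure Δ DNE) (reify (¬' (¬' (var (# 0) ≐ var (# 1)))) ρ {w} h σ)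
    where
    ρ : Fin 2 → Tm
    ρ = s ∷ t ∷ []
  ⊩-stable (A ⊃ B) h w⊆v a = ⊩-stable B λ v⊆u ¬b →
    h (extends λ σ p → weaken v⊆u σ (weaken w⊆v σ p)) λ u⊆z f →
      ¬b u⊆z (f ⊆ʷ-refl (mono A (extends λ σ p → weaken u⊆z σ (weaken v⊆u σ p)) a))
  ⊩-stable (Π F)   h x = ⊩-stable (F x) λ w⊆v ¬f →
    h w⊆v λ v⊆u f → ¬f v⊆u (f x)

  -- Natural deduction, sound for forcing

  infix 0 _⊢_
  record _⊢_ (Γ : List Pr) (A : Pr) : Set where
    constructor forced
    field
      force : ∀ {w} → All (w ⊩_) Γ → w ⊩ A
  open _⊢_ public

  ⊢-axiom : ∀ {A Γ} → T A → Γ ⊢ ⟪ A ⟫ []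
  ⊢-axiom {A} a .force {w} _ = reflect A [] λ σ →
    pure (map (close σ) w) (subst (Prf T) (sentence (inst σ ∘ [])) (axiom a))
    where
    sentence : ∀ {n} (τ : Fin 0 → Term n) → wkSentence A ≡ subF τ A
    sentence τ = trans (renF≡subF (λ ()) A) (subF-cong (λ ()) A)

  ⊢-closed : ∀ A → []ₗ ⊢ ⟪ A ⟫ [] → Prf T A
  ⊢-closed A d = subst (Prf T) unfold (reify A [] {[]ₗ} (d .force []ₐ) σ)
    where
    σ : ℕ → Term 0
    -- A sentence contains no names, so `ε` is merely a default value.
    σ _ = ε
    unfold : subF (inst σ ∘ []) A ≡ A
    unfold = trans (subF-cong (λ ()) A) (subF-id A)

  wk₁ : ∀ {Γ A B} → Γ ⊢ A → B ∷ₗ Γ ⊢ A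
  wk₁ h .force (_ ∷ₐ γ) = h .force γ

  wk* : ∀ {Γ A} → []ₗ ⊢ A → Γ ⊢ A
  wk* h .force _ = h .force []ₐ

  infix 9 ↑_
  ↑_ : ∀ {Γ Δ A} {{_ : Γ ⊑ Δ}} → Γ ⊢ A → Δ ⊢ A
  ↑_ {Γ} {Δ} {{eq}} h .force {w} γ =
    h .force (subst (All (w ⊩_)) eq (drop⁺ (length Δ ∸ length Γ) γ))

  top : ∀ {Γ A} → A ∷ₗ Γ ⊢ A
  top .force (a ∷ₐ _) = a

  -- A hypothesis is usable in every extension of the context in which it was
  -- introduced, so that hypotheses can be named by Agda variables.
  Hyp : Pr → List Pr → Set
  Hyp A Γ = ∀ {Δ} {{_ : A ∷ₗ Γ ⊑ Δ}} → Δ ⊢ A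

  infixl 9 _·_
  infixl 9 _$$_

  deduce : ∀ {Γ A B} → A ∷ₗ Γ ⊢ B → Γ ⊢ A ⊃ B
  deduce d .force γ w⊆v a = d .force (a ∷ₐ All.map (λ {C} → mono C w⊆v) γ)

  ƛ : ∀ {Γ A B} → (Hyp A Γ → A ∷ₗ Γ ⊢ B) → Γ ⊢ A ⊃ B
  ƛ f = deduce (f (↑ top))

  _·_ : ∀ {Γ A B} → Γ ⊢ A ⊃ B → Γ ⊢ A → Γ ⊢ B
  (f · a) .force γ = f .force γ ⊆ʷ-refl (a .force γ)

  Λ : ∀ {Γ F} → (∀ x → Γ ⊢ F x) → Γ ⊢ Π F
  Λ f .force γ x = f x .force γ

  _$$_ : ∀ {Γ F} → Γ ⊢ Π F → ∀ x → Γ ⊢ F x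
  (f $$ x) .force γ = f .force γ x

  stable : ∀ {Γ A} → Γ ⊢ ¬ ¬ A → Γ ⊢ A
  stable {A = A} h .force γ = ⊩-stable A (h .force γ)

  ≈-refl : ∀ {Γ x} → Γ ⊢ x ≈ x
  ≈-refl {x = x} .force {w} _ σ = pure (map (close σ) w) (Refl (inst σ x))

  -- Equality acts only on propositions that come from a formula, because the underlying `Leib`
  -- does; hence the explicit `φ` and `ρ`.
  leibniz : ∀ {Γ n} (φ : Fm (suc n)) (ρ : Fin n → Tm) {x y} →
            Γ ⊢ x ≈ y → Γ ⊢ ⟪ φ ⟫ (x ∷ ρ) → Γ ⊢ ⟪ φ ⟫ (y ∷ ρ)
  leibniz φ ρ {x} {y} p h .force {w} γ = reflect φ (y ∷ ρ) λ σ →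
    let Δ = map (close σ) w in
    subst (λ χ → Prf T (Δ ⇛ χ)) (unfold σ y)
      (app Δ (app Δ (pure Δ (Leib (subF (liftSub (inst σ ∘ ρ)) φ) (inst σ x) (inst σ y)))
        (p .force γ σ))
        (subst (λ χ → Prf T (Δ ⇛ χ)) (sym (unfold σ x)) (reify φ (x ∷ ρ) (h .force γ) σ)))
    where
    unfold : ∀ {m} (σ : ℕ → Term m) z →
             subF (liftSub (inst σ ∘ ρ)) φ [ inst σ z ] ≡ close σ (closure φ (z ∷ ρ))
    unfold σ z = trans (subF-[] (inst σ z) (inst σ ∘ ρ) φ)
      (subF-cong (λ { zero → refl ; (suc i) → refl }) φ)

open Forcing Seq

-- Derived rules of classical logic and equality

⊥E : ∀ {Γ A} → Γ ⊢ ⊥ᵖ → Γ ⊢ A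
⊥E h = stable (deduce (wk₁ h))

infixr 4 _,ᵖ_

_,ᵖ_ : ∀ {Γ A B} → Γ ⊢ A → Γ ⊢ B → Γ ⊢ A ∧ B
a ,ᵖ b = deduce (top · wk₁ a · wk₁ b)

fst : ∀ {Γ A B} → Γ ⊢ A ∧ B → Γ ⊢ A
fst h = stable (deduce (wk₁ h · deduce (⊥E (wk₁ top · top))))

snd : ∀ {Γ A B} → Γ ⊢ A ∧ B → Γ ⊢ B
snd h = stable (deduce (wk₁ h · deduce (wk₁ top)))

inl : ∀ {Γ A B} → Γ ⊢ A → Γ ⊢ A ∨ B
inl a = deduce (⊥E (top · wk₁ a))

inr : ∀ {Γ A B} → Γ ⊢ B → Γ ⊢ A ∨ B
inr b = deduce (wk₁ b)

by-cases : ∀ {Γ} A {C} → (Hyp A Γ → A ∷ₗ Γ ⊢ C) → (Hyp (¬ A) Γ → ¬ A ∷ₗ Γ ⊢ C) → Γ ⊢ C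
by-cases A f g =
  stable (deduce (top · (wk₁ (ƛ g) · deduce (wk₁ top · (wk₁ (wk₁ (ƛ f)) · top)))))

∨E : ∀ {Γ A B C} → Γ ⊢ A ∨ B → (Hyp A Γ → A ∷ₗ Γ ⊢ C) → (Hyp B Γ → B ∷ₗ Γ ⊢ C) → Γ ⊢ C
∨E {A = A} h f g = by-cases A f λ _ → wk₁ (ƛ g) · (wk₁ h · top)

∃I : ∀ {Γ F} x → Γ ⊢ F x → Γ ⊢ Ex F
∃I x a = deduce (top $$ x · wk₁ a)

∃E : ∀ {Γ F C} → Γ ⊢ Ex F → (∀ x → Hyp (F x) Γ → F x ∷ₗ Γ ⊢ C) → Γ ⊢ C
∃E h f = stable (deduce (wk₁ h · Λ λ x → deduce (wk₁ top · (wk₁ (wk₁ (ƛ (f x))) · top))))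

≈-sym : ∀ {Γ x y} → Γ ⊢ x ≈ y → Γ ⊢ y ≈ x
≈-sym {x = x} p = leibniz (var (# 0) ≐ var (# 1)) (x ∷ []) p ≈-refl

≈-trans : ∀ {Γ x y z} → Γ ⊢ x ≈ y → Γ ⊢ y ≈ z → Γ ⊢ x ≈ z
≈-trans {x = x} p q = leibniz (var (# 1) ≐ var (# 0)) (x ∷ []) q p

infixr 2 _≈⟨_⟩_ _≈⟨_⟨_
infix  3 _∎

_≈⟨_⟩_ : ∀ {Γ} x {y z} → Γ ⊢ x ≈ y → Γ ⊢ y ≈ z → Γ ⊢ x ≈ z
x ≈⟨ p ⟩ q = ≈-trans p q

_≈⟨_⟨_ : ∀ {Γ} x {y z} → Γ ⊢ y ≈ x → Γ ⊢ y ≈ z → Γ ⊢ x ≈ z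
x ≈⟨ p ⟨ q = ≈-trans (≈-sym p) q

_∎ : ∀ {Γ} x → Γ ⊢ x ≈ x
x ∎ = ≈-refl

∙-cong : ∀ {Γ x x' y y'} → Γ ⊢ x ≈ x' → Γ ⊢ y ≈ y' → Γ ⊢ x ∙ y ≈ x' ∙ y'
∙-cong {x = x} {x'} {y} p q = ≈-trans
  (leibniz (var (# 1) ∘ₜ var (# 2) ≐ var (# 0) ∘ₜ var (# 2)) (x ∷ y ∷ []) p ≈-refl)
  (leibniz (var (# 1) ∘ₜ var (# 2) ≐ var (# 1) ∘ₜ var (# 0)) (x' ∷ y ∷ []) q ≈-refl)

▷-cong : ∀ {Γ x x' y y'} → Γ ⊢ x ≈ x' → Γ ⊢ y ≈ y' → Γ ⊢ x ▷ y ≈ x' ▷ y'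
▷-cong {x = x} {x'} {y} p q = ≈-trans
  (leibniz (var (# 1) ⊢ₜ var (# 2) ≐ var (# 0) ⊢ₜ var (# 2)) (x ∷ y ∷ []) p ≈-refl)
  (leibniz (var (# 1) ⊢ₜ var (# 2) ≐ var (# 1) ⊢ₜ var (# 0)) (x' ∷ y ∷ []) q ≈-refl)

-- The axioms of Seq

▷-inj : ∀ {Γ x₁ x₂ y₁ y₂} → Γ ⊢ x₁ ▷ x₂ ≈ y₁ ▷ y₂ → Γ ⊢ x₁ ≈ y₁ ∧ x₂ ≈ y₂
▷-inj {x₁ = x₁} {x₂} {y₁} {y₂} p = ⊢-axiom seq₂ $$ x₁ $$ x₂ $$ y₁ $$ y₂ · p

▷-injˡ : ∀ {Γ x₁ x₂ y₁ y₂} → Γ ⊢ x₁ ▷ x₂ ≈ y₁ ▷ y₂ → Γ ⊢ x₁ ≈ y₁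
▷-injˡ p = fst (▷-inj p)

▷-injʳ : ∀ {Γ x₁ x₂ y₁ y₂} → Γ ⊢ x₁ ▷ x₂ ≈ y₁ ▷ y₂ → Γ ⊢ x₂ ≈ y₂
▷-injʳ p = snd (▷-inj p)

▷≉e : ∀ {Γ x y C} → Γ ⊢ x ▷ y ≈ e → Γ ⊢ C
▷≉e {x = x} {y} p = ⊥E (⊢-axiom seq₁ $$ x $$ y · p)

∙-e : ∀ {Γ} x → Γ ⊢ x ∙ e ≈ x
∙-e x = ⊢-axiom seq₃ $$ x

∙-▷ : ∀ {Γ} x y z → Γ ⊢ x ∙ (y ▷ z) ≈ x ∙ y ▷ z
∙-▷ x y z = ⊢-axiom seq₄ $$ x $$ y $$ z

∃E₂ : ∀ {Γ C} {F : Tm → Tm → Pr} → Γ ⊢ Ex (λ x → Ex (F x)) →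
      (∀ x y → Hyp (F x y) Γ → F x y ∷ₗ Γ ⊢ C) → Γ ⊢ C
∃E₂ h f = ∃E h λ x _ → ∃E top λ y _ → wk₁ (wk₁ (ƛ (f x y))) · top

case-e▷ : ∀ {Γ C} x → (Hyp (x ≈ e) Γ → x ≈ e ∷ₗ Γ ⊢ C) →
          (∀ y z → Hyp (x ≈ y ▷ z) Γ → x ≈ y ▷ z ∷ₗ Γ ⊢ C) → Γ ⊢ C
case-e▷ x f g = ∨E (⊢-axiom seq₅ $$ x) f λ _ →
  ∃E₂ top λ y z _ → wk₁ (wk₁ (ƛ (g y z))) · top

∙-singleton : ∀ {Γ} x a → Γ ⊢ x ∙ (e ▷ a) ≈ x ▷ a
∙-singleton x a =
  x ∙ (e ▷ a)  ≈⟨ ∙-▷ x e a ⟩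
  x ∙ e ▷ a    ≈⟨ ▷-cong (∙-e x) ≈-refl ⟩
  x ▷ a        ∎

-- Case analysis on `y` replaces induction: a nonempty `y` would make the product nonempty.
∙≈e⇒≈eˡ : ∀ {Γ} x y → Γ ⊢ x ∙ y ≈ e ⊃ x ≈ e
∙≈e⇒≈eˡ x y = wk* (ƛ λ p → case-e▷ y
  (λ q → x ≈⟨ ∙-e x ⟨ x ∙ e ≈⟨ ∙-cong ≈-refl q ⟨ x ∙ y ≈⟨ p ⟩ e ∎)
  (λ y' a q → ▷≉e
    (x ∙ y' ▷ a ≈⟨ ∙-▷ x y' a ⟨ x ∙ (y' ▷ a) ≈⟨ ∙-cong ≈-refl q ⟨ x ∙ y ≈⟨ p ⟩ e ∎)))

-- A definable cut closed under concatenation and satisfying the new axioms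

infix 9 _at_

_at_ : ∀ {n} → Fm 1 → Fin n → Fm n
φ at i = renF (λ _ → i) φ

[_]ᵖ : Fm 1 → Tm → Pr
[ φ ]ᵖ x = ⟪ φ ⟫ (x ∷ [])

respects : ∀ {Γ} φ {x y} → Γ ⊢ x ≈ y → Γ ⊢ [ φ ]ᵖ x → Γ ⊢ [ φ ]ᵖ y
respects φ = leibniz φ []

regularF editorF semiF acyclicF goodF : Fm 1

-- Every clause has the element as the rightmost factor and leaves the other factors arbitrary; this
-- form survives concatenation.
regularF = (ε ∘ₜ var (# 0) ≐ var (# 0))
  ∧' ∀' (∀' (var (# 1) ∘ₜ (var (# 0) ∘ₜ var (# 2)) ≐ var (# 1) ∘ₜ var (# 0) ∘ₜ var (# 2)))
  ∧' ∀' (∀' (var (# 1) ∘ₜ var (# 2) ≐ var (# 0) ∘ₜ var (# 2) ⇒ var (# 1) ≐ var (# 0)))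

-- Of the other three sequences only the right factor `w` is restricted, and only to be regular, so
-- the definition is not circular.
editorF = ∀' (∀' (∀' (regularF at (# 0)
  ⇒ var (# 2) ∘ₜ var (# 3) ≐ var (# 1) ∘ₜ var (# 0)
  ⇒ ∃' ((var (# 2) ≐ var (# 3) ∘ₜ var (# 0) ∧' var (# 0) ∘ₜ var (# 1) ≐ var (# 4))
    ∨' (var (# 3) ≐ var (# 2) ∘ₜ var (# 0) ∧' var (# 0) ∘ₜ var (# 4) ≐ var (# 1))))))

semiF = regularF ∧' editorF

-- The quantification over all prefixes makes the property descend to prefixes; the remainder `e`
-- gives the case of the element itself.
acyclicF = ∀' (∀' (∀' (semiF at (# 1) ⇒ semiF at (# 0)
  ⇒ var (# 3) ≐ var (# 2) ∘ₜ var (# 1)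
  ⇒ var (# 2) ∘ₜ var (# 0) ≐ var (# 2)
  ⇒ var (# 0) ≐ ε)))

goodF = semiF ∧' acyclicF

Regular Editor Semi Acyclic Good : Tm → Pr
Regular = [ regularF ]ᵖ
Editor  = [ editorF ]ᵖ
Semi    = [ semiF ]ᵖ
Acyclic = [ acyclicF ]ᵖ
Good    = [ goodF ]ᵖ

unitˡ : ∀ {Γ x} → Γ ⊢ Regular x → Γ ⊢ e ∙ x ≈ x
unitˡ h = fst h

assoc : ∀ {Γ x} y z → Γ ⊢ Regular x → Γ ⊢ y ∙ (z ∙ x) ≈ y ∙ z ∙ x
assoc y z h = fst (snd h) $$ y $$ z

cancelʳ : ∀ {Γ x y z} → Γ ⊢ Regular x → Γ ⊢ y ∙ x ≈ z ∙ x → Γ ⊢ y ≈ z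
cancelʳ {y = y} {z} h p = snd (snd h) $$ y $$ z · p

regular-e : ∀ {Γ} → Γ ⊢ Regular e
regular-e = wk* (∙-e e
  ,ᵖ (Λ λ y → Λ λ z → y ∙ (z ∙ e) ≈⟨ ∙-cong ≈-refl (∙-e z) ⟩ y ∙ z ≈⟨ ∙-e (y ∙ z) ⟨ y ∙ z ∙ e ∎)
  ,ᵖ (Λ λ y → Λ λ z → ƛ λ p → y ≈⟨ ∙-e y ⟨ y ∙ e ≈⟨ p ⟩ z ∙ e ≈⟨ ∙-e z ⟩ z ∎))

regular-singleton : ∀ {Γ} a → Γ ⊢ Regular (e ▷ a)
regular-singleton a = wk* (∙-singleton e a
  ,ᵖ (Λ λ y → Λ λ z →
      y ∙ (z ∙ (e ▷ a)) ≈⟨ ∙-cong ≈-refl (∙-singleton z a) ⟩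
      y ∙ (z ▷ a)       ≈⟨ ∙-▷ y z a ⟩
      y ∙ z ▷ a         ≈⟨ ∙-singleton (y ∙ z) a ⟨
      y ∙ z ∙ (e ▷ a)   ∎)
  ,ᵖ (Λ λ y → Λ λ z → ƛ λ p → ▷-injˡ
      (y ▷ a ≈⟨ ∙-singleton y a ⟨ y ∙ (e ▷ a) ≈⟨ p ⟩ z ∙ (e ▷ a) ≈⟨ ∙-singleton z a ⟩ z ▷ a ∎)))

regular-∙ : ∀ {Γ} x y → Γ ⊢ Regular x ⊃ Regular y ⊃ Regular (x ∙ y)
regular-∙ x y = wk* (ƛ λ rx → ƛ λ ry →
  (e ∙ (x ∙ y) ≈⟨ assoc e x ry ⟩ e ∙ x ∙ y ≈⟨ ∙-cong (unitˡ rx) ≈-refl ⟩ x ∙ y ∎)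
  ,ᵖ (Λ λ u → Λ λ v →
      u ∙ (v ∙ (x ∙ y)) ≈⟨ ∙-cong ≈-refl (assoc v x ry) ⟩
      u ∙ (v ∙ x ∙ y)   ≈⟨ assoc u (v ∙ x) ry ⟩
      u ∙ (v ∙ x) ∙ y   ≈⟨ ∙-cong (assoc u v rx) ≈-refl ⟩
      u ∙ v ∙ x ∙ y     ≈⟨ assoc (u ∙ v) x ry ⟨
      u ∙ v ∙ (x ∙ y)   ∎)
  ,ᵖ (Λ λ u → Λ λ v → ƛ λ p → cancelʳ rx (cancelʳ ry
      (u ∙ x ∙ y ≈⟨ assoc u x ry ⟨ u ∙ (x ∙ y) ≈⟨ p ⟩ v ∙ (x ∙ y) ≈⟨ assoc v x ry ⟩ v ∙ x ∙ y ∎))))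

-- Append `y`, reassociate and cancel. This places the overlaps produced by the editor axiom back in
-- the class.
regular-prefix : ∀ {Γ} x y → Γ ⊢ Regular (x ∙ y) ⊃ Regular y ⊃ Regular x
regular-prefix x y = wk* (ƛ λ rxy → ƛ λ ry →
  cancelʳ ry (e ∙ x ∙ y ≈⟨ assoc e x ry ⟨ e ∙ (x ∙ y) ≈⟨ unitˡ rxy ⟩ x ∙ y ∎)
  ,ᵖ (Λ λ u → Λ λ v → cancelʳ ry
      (u ∙ (v ∙ x) ∙ y   ≈⟨ assoc u (v ∙ x) ry ⟨
       u ∙ (v ∙ x ∙ y)   ≈⟨ ∙-cong ≈-refl (assoc v x ry) ⟨
       u ∙ (v ∙ (x ∙ y)) ≈⟨ assoc u v rxy ⟩
       u ∙ v ∙ (x ∙ y)   ≈⟨ assoc (u ∙ v) x ry ⟩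
       u ∙ v ∙ x ∙ y     ∎))
  ,ᵖ (Λ λ u → Λ λ v → ƛ λ p → cancelʳ rxy
      (u ∙ (x ∙ y) ≈⟨ assoc u x ry ⟩ u ∙ x ∙ y ≈⟨ ∙-cong p ≈-refl ⟩
       v ∙ x ∙ y ≈⟨ assoc v x ry ⟨ v ∙ (x ∙ y) ∎)))

Overlapˡ Overlapʳ : Tm → Tm → Tm → Tm → Tm → Pr
Overlapˡ x y z w u = z ≈ x ∙ u ∧ u ∙ w ≈ y
Overlapʳ x y z w u = x ≈ z ∙ u ∧ u ∙ y ≈ w

edit : ∀ {Γ x y z w C} → Γ ⊢ Editor y → Γ ⊢ Regular w → Γ ⊢ x ∙ y ≈ z ∙ w →
       (∀ u → Hyp (Overlapˡ x y z w u) Γ → Overlapˡ x y z w u ∷ₗ Γ ⊢ C) →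
       (∀ u → Hyp (Overlapʳ x y z w u) Γ → Overlapʳ x y z w u ∷ₗ Γ ⊢ C) → Γ ⊢ C
edit {x = x} {z = z} {w} h rw p f g = ∃E (h $$ x $$ z $$ w · rw · p) λ u _ →
  ∨E top (λ _ → wk₁ (wk₁ (ƛ (f u))) · top) (λ _ → wk₁ (wk₁ (ƛ (g u))) · top)

editor-e : ∀ {Γ} → Γ ⊢ Editor e
editor-e = wk* (Λ λ x → Λ λ z → Λ λ w → ƛ λ rw → ƛ λ p →
  ∃I w (inr ((x ≈⟨ ∙-e x ⟨ x ∙ e ≈⟨ p ⟩ z ∙ w ∎) ,ᵖ ∙-e w)))

-- If `w` is empty the overlap is the singleton itself. Otherwise both sides end in the same entry,
-- and the overlap is `w` without it.
editor-singleton : ∀ {Γ} a → Γ ⊢ Editor (e ▷ a)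
editor-singleton a = wk* (Λ λ x → Λ λ z → Λ λ w → ƛ λ rw → ƛ λ p → case-e▷ w
  (λ q → ∃I (e ▷ a) (inl
    ((z ≈⟨ ∙-e z ⟨ z ∙ e ≈⟨ ∙-cong ≈-refl q ⟨ z ∙ w ≈⟨ p ⟨ x ∙ (e ▷ a) ∎)
    ,ᵖ ((e ▷ a) ∙ w ≈⟨ ∙-cong ≈-refl q ⟩ (e ▷ a) ∙ e ≈⟨ ∙-e (e ▷ a) ⟩ e ▷ a ∎))))
  (λ w' b q → ƛ (λ r → ∃I w' (inr
    (▷-injˡ r
    ,ᵖ (w' ∙ (e ▷ a) ≈⟨ ∙-singleton w' a ⟩ w' ▷ a ≈⟨ ▷-cong ≈-refl (▷-injʳ r) ⟩ w' ▷ b ≈⟨ q ⟨ w ∎))))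
    · (x ▷ a        ≈⟨ ∙-singleton x a ⟨
       x ∙ (e ▷ a)  ≈⟨ p ⟩
       z ∙ w        ≈⟨ ∙-cong ≈-refl q ⟩
       z ∙ (w' ▷ b) ≈⟨ ∙-▷ z w' b ⟩
       z ∙ w' ▷ b   ∎)))

-- Apply the editor property of `y'` to `(x ∙ y) ∙ y'`. Either the boundary of `z ∙ w` falls inside
-- `y'`, and the overlap is `y ∙ u`, or it falls earlier, and the editor property of `y` locates it.
editor-∙ : ∀ {Γ} y y' → Γ ⊢ Editor y ⊃ Regular y' ⊃ Editor y' ⊃ Editor (y ∙ y')
editor-∙ y y' = wk* (ƛ λ ey → ƛ λ ry' → ƛ λ ey' → Λ λ x → Λ λ z → Λ λ w → ƛ λ rw → ƛ λ p →
  edit {x = x ∙ y} {y'} {z} {w} ey' rw (x ∙ y ∙ y' ≈⟨ assoc x y ry' ⟨ x ∙ (y ∙ y') ≈⟨ p ⟩ z ∙ w ∎)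
    (λ u h → ƛ (λ ru → ∃I (y ∙ u) (inl
        ((z ≈⟨ fst h ⟩ x ∙ y ∙ u ≈⟨ assoc x y ru ⟨ x ∙ (y ∙ u) ∎)
        ,ᵖ (y ∙ u ∙ w ≈⟨ assoc y u rw ⟨ y ∙ (u ∙ w) ≈⟨ ∙-cong ≈-refl (snd h) ⟩ y ∙ y' ∎))))
      · (regular-prefix u w · respects regularF (≈-sym (snd h)) ry' · rw))
    (λ u h → ƛ (λ ru → edit {x = x} {y} {z} {u} ey ru (fst h)
        (λ v k → ∃I v (inl (fst k
          ,ᵖ (v ∙ w ≈⟨ ∙-cong ≈-refl (snd h) ⟨ v ∙ (u ∙ y') ≈⟨ assoc v u ry' ⟩
              v ∙ u ∙ y' ≈⟨ ∙-cong (snd k) ≈-refl ⟩ y ∙ y' ∎))))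
        (λ v k → ∃I v (inr (fst k
          ,ᵖ (v ∙ (y ∙ y') ≈⟨ assoc v y ry' ⟩ v ∙ y ∙ y' ≈⟨ ∙-cong (snd k) ≈-refl ⟩
              u ∙ y' ≈⟨ snd h ⟩ w ∎)))))
      · (regular-prefix u y' · respects regularF (≈-sym (snd h)) rw · ry')))

-- Append `y'` to both sides of the equation, edit, and cancel `y'` again.
editor-prefix : ∀ {Γ} y y' → Γ ⊢ Editor (y ∙ y') ⊃ Regular y' ⊃ Editor y
editor-prefix y y' = wk* (ƛ λ eyy' → ƛ λ ry' → Λ λ x → Λ λ z → Λ λ w → ƛ λ rw → ƛ λ p →
  edit {x = x} {y ∙ y'} {z} {w ∙ y'} eyy' (regular-∙ w y' · rw · ry')
    (x ∙ (y ∙ y') ≈⟨ assoc x y ry' ⟩ x ∙ y ∙ y' ≈⟨ ∙-cong p ≈-refl ⟩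
     z ∙ w ∙ y' ≈⟨ assoc z w ry' ⟨ z ∙ (w ∙ y') ∎)
    (λ u h → ∃I u (inl (fst h ,ᵖ cancelʳ ry'
      (u ∙ w ∙ y' ≈⟨ assoc u w ry' ⟨ u ∙ (w ∙ y') ≈⟨ snd h ⟩ y ∙ y' ∎))))
    (λ u h → ∃I u (inr (fst h ,ᵖ cancelʳ ry'
      (u ∙ y ∙ y' ≈⟨ assoc u y ry' ⟨ u ∙ (y ∙ y') ≈⟨ snd h ⟩ w ∙ y' ∎)))))

semi-e : ∀ {Γ} → Γ ⊢ Semi e
semi-e = regular-e ,ᵖ editor-e

semi-∙ : ∀ {Γ} x y → Γ ⊢ Semi x ⊃ Semi y ⊃ Semi (x ∙ y)
semi-∙ x y = wk* (ƛ λ sx → ƛ λ sy →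
  regular-∙ x y · fst sx · fst sy ,ᵖ editor-∙ x y · snd sx · fst sy · snd sy)

semi-prefix : ∀ {Γ} x y → Γ ⊢ Semi (x ∙ y) ⊃ Semi y ⊃ Semi x
semi-prefix x y = wk* (ƛ λ sxy → ƛ λ sy →
  regular-prefix x y · fst sxy · fst sy ,ᵖ editor-prefix x y · snd sxy · fst sy)

acyclic-e : ∀ {Γ} → Γ ⊢ Acyclic e
acyclic-e = wk* (Λ λ y → Λ λ z → Λ λ u → ƛ λ sz → ƛ λ su → ƛ λ p → ƛ λ q →
  ƛ (λ y≈e → u ≈⟨ unitˡ (fst su) ⟨ e ∙ u ≈⟨ ∙-cong y≈e ≈-refl ⟨ y ∙ u ≈⟨ q ⟩ y ≈⟨ y≈e ⟩ e ∎)
  · (∙≈e⇒≈eˡ y z · ≈-sym p))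

-- A prefix `y` is `e` or the whole singleton. In the first case the left unit law gives `u ≈ e`; in
-- the second a nonempty `u` would force `y ≈ e`.
acyclic-singleton : ∀ {Γ} a → Γ ⊢ Acyclic (e ▷ a)
acyclic-singleton a = wk* (Λ λ y → Λ λ z → Λ λ u → ƛ λ sz → ƛ λ su → ƛ λ p → ƛ λ q → case-e▷ z
  (λ z≈e → ƛ (λ r → case-e▷ u (λ u≈e → u≈e) λ u' b s → ▷≉e
      (e ▷ a ≈⟨ r ⟩
       y     ≈⟨ ∙≈e⇒≈eˡ y u' · ▷-injˡ
                (y ∙ u' ▷ b   ≈⟨ ∙-▷ y u' b ⟨
                 y ∙ (u' ▷ b) ≈⟨ ∙-cong ≈-refl s ⟨
                 y ∙ u        ≈⟨ q ⟩
                 y            ≈⟨ r ⟨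
                 e ▷ a        ∎) ⟩
       e     ∎))
    · (e ▷ a ≈⟨ p ⟩ y ∙ z ≈⟨ ∙-cong ≈-refl z≈e ⟩ y ∙ e ≈⟨ ∙-e y ⟩ y ∎))
  (λ z' b s →
    ƛ (λ y≈e → u ≈⟨ unitˡ (fst su) ⟨ e ∙ u ≈⟨ ∙-cong y≈e ≈-refl ⟨ y ∙ u ≈⟨ q ⟩ y ≈⟨ y≈e ⟩ e ∎)
    · (∙≈e⇒≈eˡ y z' · ▷-injˡ
        (y ∙ z' ▷ b   ≈⟨ ∙-▷ y z' b ⟨
         y ∙ (z' ▷ b) ≈⟨ ∙-cong ≈-refl s ⟨
         y ∙ z        ≈⟨ p ⟨
         e ▷ a        ∎))))

-- Edit `x ∙ x' ≈ y ∙ z`. If `y` is a prefix of `x`, acyclicity of `x` suffices. If `y ≈ x ∙ t`,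
-- then `t` is a prefix of `x'`, and it remains to show `t ∙ u ≈ t`.
acyclic-∙ : ∀ {Γ} x x' → Γ ⊢ Acyclic x ⊃ Semi x' ⊃ Acyclic x' ⊃ Acyclic (x ∙ x')
acyclic-∙ x x' = wk* (ƛ λ ax → ƛ λ sx' → ƛ λ ax' →
  Λ λ y → Λ λ z → Λ λ u → ƛ λ sz → ƛ λ su → ƛ λ p → ƛ λ q →
  edit {x = x} {x'} {y} {z} (snd sx') (fst sz) p
    (λ t h →
      ƛ (λ st → ax' $$ t $$ z $$ u · sz · su · ≈-sym (snd h)
        -- Here `x` is cancelled on the left: either overlap `s` satisfies `x ≈ x ∙ s`, so
        -- acyclicity of `x` makes it empty.
        · edit {x = x} {t} {x} {t ∙ u} (snd st) (fst (semi-∙ t u · st · su))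
            (x ∙ t     ≈⟨ fst h ⟨
             y         ≈⟨ q ⟨
             y ∙ u     ≈⟨ ∙-cong (fst h) ≈-refl ⟩
             x ∙ t ∙ u ≈⟨ assoc x t (fst su) ⟨
             x ∙ (t ∙ u) ∎)
            (λ s k →
              ƛ (λ s≈e →
                t ∙ u       ≈⟨ unitˡ (fst (semi-∙ t u · st · su)) ⟨
                e ∙ (t ∙ u) ≈⟨ ∙-cong s≈e ≈-refl ⟨
                s ∙ (t ∙ u) ≈⟨ snd k ⟩
                t           ∎)
              · (ax $$ x $$ e $$ s · semi-e
                 · (semi-prefix s (t ∙ u) · respects semiF (≈-sym (snd k)) st · (semi-∙ t u · st · su))
                 · ≈-sym (∙-e x) · ≈-sym (fst k)))
            (λ s k →
              ƛ (λ s≈e →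
                t ∙ u ≈⟨ snd k ⟨
                s ∙ t ≈⟨ ∙-cong s≈e ≈-refl ⟩
                e ∙ t ≈⟨ unitˡ (fst st) ⟩
                t     ∎)
              · (ax $$ x $$ e $$ s · semi-e
                 · (semi-prefix s t · respects semiF (≈-sym (snd k)) (semi-∙ t u · st · su) · st)
                 · ≈-sym (∙-e x) · ≈-sym (fst k))))
      · (semi-prefix t z · respects semiF (≈-sym (snd h)) sx' · sz))
    (λ t h → ax $$ y $$ t $$ u
      · (semi-prefix t x' · respects semiF (≈-sym (snd h)) sz · sx') · su · fst h · q))

acyclic-prefix : ∀ {Γ} x x' → Γ ⊢ Acyclic (x ∙ x') ⊃ Semi x' ⊃ Acyclic x
acyclic-prefix x x' = wk* (ƛ λ axx' → ƛ λ sx' →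
  Λ λ y → Λ λ z → Λ λ u → ƛ λ sz → ƛ λ su → ƛ λ p → ƛ λ q →
  axx' $$ y $$ (z ∙ x') $$ u · (semi-∙ z x' · sz · sx') · su
  · (x ∙ x' ≈⟨ ∙-cong p ≈-refl ⟩ y ∙ z ∙ x' ≈⟨ assoc y z (fst sx') ⟨ y ∙ (z ∙ x') ∎) · q)

good-e : ∀ {Γ} → Γ ⊢ Good e
good-e = semi-e ,ᵖ acyclic-e

good-singleton : ∀ {Γ} a → Γ ⊢ Good (e ▷ a)
good-singleton a = (regular-singleton a ,ᵖ editor-singleton a) ,ᵖ acyclic-singleton a

good-∙ : ∀ {Γ} x y → Γ ⊢ Good x ⊃ Good y ⊃ Good (x ∙ y)
good-∙ x y = wk* (ƛ λ gx → ƛ λ gy →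
  semi-∙ x y · fst gx · fst gy ,ᵖ acyclic-∙ x y · snd gx · fst gy · snd gy)

good-prefix : ∀ {Γ} x y → Γ ⊢ Good (x ∙ y) ⊃ Good y ⊃ Good x
good-prefix x y = wk* (ƛ λ gxy → ƛ λ gy →
  semi-prefix x y · fst gxy · fst gy ,ᵖ acyclic-prefix x y · snd gxy · fst gy)

good-▷ : ∀ {Γ} x a → Γ ⊢ Good x ⊃ Good (x ▷ a)
good-▷ x a = wk* (ƛ λ gx →
  respects goodF (∙-singleton x a) (good-∙ x (e ▷ a) · gx · good-singleton a))

good-▷⁻¹ : ∀ {Γ} x a → Γ ⊢ Good (x ▷ a) ⊃ Good x
good-▷⁻¹ x a = wk* (ƛ λ g →
  good-prefix x (e ▷ a) · respects goodF (≈-sym (∙-singleton x a)) g · good-singleton a)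

good-unitˡ : ∀ {Γ x} → Γ ⊢ Good x → Γ ⊢ e ∙ x ≈ x
good-unitˡ g = unitˡ (fst (fst g))

good-cancelʳ : ∀ {Γ x y z} → Γ ⊢ Good x → Γ ⊢ y ∙ x ≈ z ∙ x → Γ ⊢ y ≈ z
good-cancelʳ g p = cancelʳ (fst (fst g)) p

-- Editing yields an overlap `u` with `x ≈ x ∙ u`, which acyclicity of `x` makes empty.
good-cancelˡ : ∀ {Γ} x y z → Γ ⊢ Good x ⊃ Good y ⊃ Good z ⊃ x ∙ y ≈ x ∙ z ⊃ y ≈ z
good-cancelˡ x y z = wk* (ƛ λ gx → ƛ λ gy → ƛ λ gz → ƛ λ p →
  edit {x = x} {y} {x} {z} (snd (fst gy)) (fst (fst gz)) p
    (λ u h →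
      ƛ (λ u≈e → y ≈⟨ snd h ⟨ u ∙ z ≈⟨ ∙-cong u≈e ≈-refl ⟩ e ∙ z ≈⟨ good-unitˡ gz ⟩ z ∎)
      · (snd gx $$ x $$ e $$ u · semi-e
         · (semi-prefix u z · respects semiF (≈-sym (snd h)) (fst gy) · fst gz)
         · ≈-sym (∙-e x) · ≈-sym (fst h)))
    (λ u h →
      ƛ (λ u≈e → y ≈⟨ good-unitˡ gy ⟨ e ∙ y ≈⟨ ∙-cong u≈e ≈-refl ⟨ u ∙ y ≈⟨ snd h ⟩ z ∎)
      · (snd gx $$ x $$ e $$ u · semi-e
         · (semi-prefix u y · respects semiF (≈-sym (snd h)) (fst gz) · fst gy)
         · ≈-sym (∙-e x) · ≈-sym (fst h))))

-- A definable bijection from the universe onto the cut.  It is the identity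
-- except on the elements outside the cut and on the pairs n ▷ c with n a
-- numeral and c outside the cut: it sends c to e ▷ c and n ▷ c to (n ▷ e) ▷ c.

numeralF taggedF : Fm 1

-- The equation says that the entries of n are all e.
numeralF = goodF ∧' (ε ⊢ₜ ε) ∘ₜ var (# 0) ≐ var (# 0) ⊢ₜ ε

taggedF = ∃' (∃' (numeralF at (# 1) ∧' ¬' (goodF at (# 0)) ∧' var (# 2) ≐ var (# 1) ⊢ₜ var (# 0)))

-- Variable 0 is the source and variable 1 its image; the disjuncts are `Outside`, `Shifted` and
-- `Fixed` below.
codeF : Fm 2
codeF = (¬' (goodF at (# 0)) ∧' var (# 1) ≐ ε ⊢ₜ var (# 0))
  ∨' ∃' (∃' (numeralF at (# 1) ∧' ¬' (goodF at (# 0))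
       ∧' var (# 2) ≐ var (# 1) ⊢ₜ var (# 0) ∧' var (# 3) ≐ var (# 1) ⊢ₜ ε ⊢ₜ var (# 0)))
  ∨' (var (# 0) ≐ var (# 1) ∧' goodF at (# 1) ∧' ¬' (taggedF at (# 1)))

Numeral Tagged : Tm → Pr
Numeral = [ numeralF ]ᵖ
Tagged  = [ taggedF ]ᵖ

Code : Tm → Tm → Pr
Code v z = ⟪ codeF ⟫ (v ∷ z ∷ [])

Outside Fixed : Tm → Tm → Pr
Outside v z = ¬ Good v ∧ z ≈ e ▷ v
Fixed v z   = v ≈ z ∧ Good z ∧ ¬ Tagged z

Shifted : Tm → Tm → Tm → Tm → Pr
Shifted v z n c = Numeral n ∧ ¬ Good c ∧ v ≈ n ▷ c ∧ z ≈ n ▷ e ▷ c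

case-code : ∀ {Γ C} v z → Γ ⊢ Code v z →
            (Hyp (Outside v z) Γ → Outside v z ∷ₗ Γ ⊢ C) →
            (∀ n c → Hyp (Shifted v z n c) Γ → Shifted v z n c ∷ₗ Γ ⊢ C) →
            (Hyp (Fixed v z) Γ → Fixed v z ∷ₗ Γ ⊢ C) → Γ ⊢ C
case-code v z h f g k = ∨E h f λ _ → ∨E top
  (λ _ → ∃E₂ top λ n c _ → wk₁ (wk₁ (wk₁ (ƛ (g n c)))) · top)
  (λ _ → wk₁ (wk₁ (ƛ k)) · top)

numeral-e : ∀ {Γ} → Γ ⊢ Numeral e
numeral-e = good-e ,ᵖ ∙-e (e ▷ e)

numeral-suc : ∀ {Γ} n → Γ ⊢ Numeral n ⊃ Numeral (n ▷ e)
numeral-suc n = wk* (ƛ λ h → good-▷ n e · fst h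
  ,ᵖ ((e ▷ e) ∙ (n ▷ e) ≈⟨ ∙-▷ (e ▷ e) n e ⟩ (e ▷ e) ∙ n ▷ e ≈⟨ ▷-cong (snd h) ≈-refl ⟩ n ▷ e ▷ e ∎))

-- Moving the last entry out of the defining equation and comparing entries gives `a ≈ e`, and then
-- the same equation for `n`.
numeral-pred : ∀ {Γ} n a → Γ ⊢ Numeral (n ▷ a) ⊃ Numeral n ∧ a ≈ e
numeral-pred n a = wk* (ƛ λ h →
  ƛ (λ p → (good-▷⁻¹ n a · fst h
      ,ᵖ ((e ▷ e) ∙ n ≈⟨ ▷-injˡ p ⟩ n ▷ a ≈⟨ ▷-cong ≈-refl (▷-injʳ p) ⟩ n ▷ e ∎))
    ,ᵖ ▷-injʳ p)
  · ((e ▷ e) ∙ n ▷ a ≈⟨ ∙-▷ (e ▷ e) n a ⟨ (e ▷ e) ∙ (n ▷ a) ≈⟨ snd h ⟩ n ▷ a ▷ e ∎))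

tagged-intro : ∀ {Γ} n c z → Γ ⊢ Numeral n ⊃ ¬ Good c ⊃ z ≈ n ▷ c ⊃ Tagged z
tagged-intro n c z = wk* (ƛ λ h → ƛ λ b → ƛ λ p → ∃I n (∃I c (h ,ᵖ b ,ᵖ p)))

numeral▷-good : ∀ {Γ} n c v → Γ ⊢ Numeral n ⊃ v ≈ n ▷ c ⊃ Good v
numeral▷-good n c v = wk* (ƛ λ h → ƛ λ p → respects goodF (≈-sym p) (good-▷ n c · fst h))

code-total : ∀ {Γ} v → Γ ⊢ Ex λ z → Good z ∧ Code v z
code-total v = wk* (by-cases (Good v)
  (λ g → by-cases (Tagged v)
    (λ t → ∃E₂ t λ n c h → ∃I (n ▷ e ▷ c)
      (good-▷ (n ▷ e) c · (good-▷ n e · fst (fst h))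
      ,ᵖ inr (inl (∃I n (∃I c (fst h ,ᵖ fst (snd h) ,ᵖ snd (snd h) ,ᵖ ≈-refl))))))
    (λ ¬t → ∃I v (g ,ᵖ inr (inr (≈-refl ,ᵖ g ,ᵖ ¬t)))))
  (λ ¬g → ∃I (e ▷ v) (good-singleton v ,ᵖ inl (¬g ,ᵖ ≈-refl))))

-- A tagged `n ▷ c` comes from `c` if `n` is empty and from the pair with the predecessor of `n`
-- otherwise; any other good element is its own preimage.
code-surjective : ∀ {Γ} z → Γ ⊢ Good z ⊃ Ex λ v → Code v z
code-surjective z = wk* (ƛ λ g → by-cases (Tagged z)
  (λ t → ∃E₂ t λ n c h → case-e▷ n
    (λ p → ∃I c (inl (fst (snd h)
      ,ᵖ (z ≈⟨ snd (snd h) ⟩ n ▷ c ≈⟨ ▷-cong p ≈-refl ⟩ e ▷ c ∎))))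
    (λ m a p → ƛ (λ k → ∃I (m ▷ c) (inr (inl (∃I m (∃I c (fst k ,ᵖ fst (snd h) ,ᵖ ≈-refl
        ,ᵖ (z ≈⟨ snd (snd h) ⟩ n ▷ c ≈⟨ ▷-cong p ≈-refl ⟩
            m ▷ a ▷ c ≈⟨ ▷-cong (▷-cong ≈-refl (snd k)) ≈-refl ⟩ m ▷ e ▷ c ∎)))))))
      · (numeral-pred m a · respects numeralF p (fst h))))
  (λ ¬t → ∃I z (inr (inr (≈-refl ,ᵖ g ,ᵖ ¬t)))))

-- The three kinds of source are disjoint: outside the cut, tagged, and good but untagged.
code-functional : ∀ {Γ} v z z' → Γ ⊢ Code v z ⊃ Code v z' ⊃ z ≈ z'
code-functional v z z' = wk* (ƛ λ c₁ → ƛ λ c₂ → case-code v z c₁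
  (λ h → case-code v z' c₂
    (λ k → z ≈⟨ snd h ⟩ e ▷ v ≈⟨ snd k ⟨ z' ∎)
    (λ n c k → ⊥E (fst h · (numeral▷-good n c v · fst k · fst (snd (snd k)))))
    (λ k → ⊥E (fst h · respects goodF (≈-sym (fst k)) (fst (snd k)))))
  (λ n c h → case-code v z' c₂
    (λ k → ⊥E (fst k · (numeral▷-good n c v · fst h · fst (snd (snd h)))))
    (λ n' c' k → ƛ (λ p →
        z            ≈⟨ snd (snd (snd h)) ⟩
        n ▷ e ▷ c    ≈⟨ ▷-cong (▷-cong (▷-injˡ p) ≈-refl) (▷-injʳ p) ⟩
        n' ▷ e ▷ c'  ≈⟨ snd (snd (snd k)) ⟨
        z'           ∎)
      · (n ▷ c ≈⟨ fst (snd (snd h)) ⟨ v ≈⟨ fst (snd (snd k)) ⟩ n' ▷ c' ∎))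
    (λ k → ⊥E (snd (snd k) · (tagged-intro n c z' · fst h · fst (snd h)
      · (z' ≈⟨ fst k ⟨ v ≈⟨ fst (snd (snd h)) ⟩ n ▷ c ∎)))))
  (λ h → case-code v z' c₂
    (λ k → ⊥E (fst k · respects goodF (≈-sym (fst h)) (fst (snd h))))
    (λ n c k → ⊥E (snd (snd h) · (tagged-intro n c z · fst k · fst (snd k)
      · (z ≈⟨ fst h ⟨ v ≈⟨ fst (snd (snd k)) ⟩ n ▷ c ∎))))
    (λ k → z ≈⟨ fst h ⟨ v ≈⟨ fst k ⟩ z' ∎)))

-- The images are disjoint as well: outside and shifted sources have tagged images, told apart by
-- whether the numeral is `e`.
code-injective : ∀ {Γ} v v' z → Γ ⊢ Code v z ⊃ Code v' z ⊃ v ≈ v'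
code-injective v v' z = wk* (ƛ λ c₁ → ƛ λ c₂ → case-code v z c₁
  (λ h → case-code v' z c₂
    (λ k → ▷-injʳ (e ▷ v ≈⟨ snd h ⟨ z ≈⟨ snd k ⟩ e ▷ v' ∎))
    (λ n c k → ▷≉e (≈-sym (▷-injˡ
      (e ▷ v ≈⟨ snd h ⟨ z ≈⟨ snd (snd (snd k)) ⟩ n ▷ e ▷ c ∎))))
    (λ k → ⊥E (snd (snd k) · (tagged-intro e v z · numeral-e · fst h · snd h))))
  (λ n c h → case-code v' z c₂
    (λ k → ▷≉e (▷-injˡ
      (n ▷ e ▷ c ≈⟨ snd (snd (snd h)) ⟨ z ≈⟨ snd k ⟩ e ▷ v' ∎)))
    (λ n' c' k → ƛ (λ p →
        v        ≈⟨ fst (snd (snd h)) ⟩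
        n ▷ c    ≈⟨ ▷-cong (▷-injˡ (▷-injˡ p)) (▷-injʳ p) ⟩
        n' ▷ c'  ≈⟨ fst (snd (snd k)) ⟨
        v'       ∎)
      · (n ▷ e ▷ c ≈⟨ snd (snd (snd h)) ⟨ z ≈⟨ snd (snd (snd k)) ⟩ n' ▷ e ▷ c' ∎))
    (λ k → ⊥E (snd (snd k) · (tagged-intro (n ▷ e) c z
      · (numeral-suc n · fst h) · fst (snd h) · snd (snd (snd h))))))
  (λ h → case-code v' z c₂
    (λ k → ⊥E (snd (snd h) · (tagged-intro e v' z · numeral-e · fst k · snd k)))
    (λ n c k → ⊥E (snd (snd h) · (tagged-intro (n ▷ e) c z
      · (numeral-suc n · fst k) · fst (snd k) · snd (snd (snd k)))))
    (λ k → v ≈⟨ fst h ⟩ z ≈⟨ fst k ⟨ v' ∎)))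

-- The interpretation

-- The bijection is used backwards: as the second argument runs through the cut, the stored entry
-- runs through the whole universe.
pairF : Fm 3
pairF = ∃' (renF (# 0 ∷ # 2 ∷ []) codeF ∧' var (# 1) ⊢ₜ var (# 0) ≐ var (# 3))

cut : Translation
cut = record
  { dim-1 = 0
  ; p     = 0
  ; α     = ⊥' ⇒ ⊥'
  ; δ     = goodF
  ; eqv   = var (# 0) ≐ var (# 1)
  ; e-gr  = var (# 0) ≐ ε
  ; ⊢-gr  = pairF
  ; ∘-gr  = var (# 0) ∘ₜ var (# 1) ≐ var (# 2)
  }

open Translation cut using (Tup; Par; ⟦_⟧; tr; tr₀)

Pair : Tm → Tm → Tm → Pr
Pair x y z = ⟪ pairF ⟫ (x ∷ y ∷ z ∷ [])

Exᵍ : (Tm → Pr) → Pr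
Exᵍ F = Ex λ x → Good x ∧ F x

Πᵍ : (Tm → Pr) → Pr
Πᵍ F = Π λ x → Good x ⊃ F x

-- Together with `Tr` this is the translation for one-element tuples, with values of variables in
-- place of tuples and renamings.
Val : ∀ {n} → Term n → (Fin n → Tm) → Tm → Pr
Val (var i)  r x = r i ≈ x
Val ε        r x = x ≈ e
Val (s ⊢ₜ t) r x = Exᵍ λ a → Exᵍ λ b → Val s r a ∧ Val t r b ∧ Pair a b x
Val (s ∘ₜ t) r x = Exᵍ λ a → Exᵍ λ b → Val s r a ∧ Val t r b ∧ a ∙ b ≈ x

Tr : ∀ {n} → Fm n → (Fin n → Tm) → Pr
Tr ⊥'      r = ⊥ᵖ
Tr (s ≐ t) r = Exᵍ λ a → Exᵍ λ b → Val s r a ∧ Val t r b ∧ a ≈ b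
Tr (φ ⇒ ψ) r = Tr φ r ⊃ Tr ψ r
Tr (∀' φ)  r = Πᵍ λ x → Tr φ (x ∷ r)

-- Equivalence of the syntactic translation with its relativised meaning

Equiv : List Pr → Pr → Pr → Set
Equiv Γ A B = (Γ ⊢ A ⊃ B) × (Γ ⊢ B ⊃ A)

equiv-refl : ∀ {Γ A} → Equiv Γ A A
equiv-refl = deduce top , deduce top

⊃-equiv : ∀ {Γ A A' B B'} → Equiv Γ A A' → Equiv Γ B B' → Equiv Γ (A ⊃ B) (A' ⊃ B')
⊃-equiv (f , f') (g , g') =
    deduce (deduce (wk₁ (wk₁ g) · (wk₁ top · (wk₁ (wk₁ f') · top))))
  , deduce (deduce (wk₁ (wk₁ g') · (wk₁ top · (wk₁ (wk₁ f) · top))))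

Π-equiv : ∀ {Γ F G} → (∀ x → Equiv Γ (F x) (G x)) → Equiv Γ (Π F) (Π G)
Π-equiv h = deduce (Λ λ x → wk₁ (proj₁ (h x)) · (top $$ x))
          , deduce (Λ λ x → wk₁ (proj₂ (h x)) · (top $$ x))

¬-equiv : ∀ {Γ A B} → Equiv Γ A B → Equiv Γ (¬ A) (¬ B)
¬-equiv f = ⊃-equiv f equiv-refl

∧-equiv : ∀ {Γ A A' B B'} → Equiv Γ A A' → Equiv Γ B B' → Equiv Γ (A ∧ B) (A' ∧ B')
∧-equiv f g = ¬-equiv (⊃-equiv f (¬-equiv g))

∨-equiv : ∀ {Γ A A' B B'} → Equiv Γ A A' → Equiv Γ B B' → Equiv Γ (A ∨ B) (A' ∨ B')
∨-equiv f g = ⊃-equiv (¬-equiv f) g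

Exᵍ-equiv : ∀ {Γ F G} → (∀ x → Equiv Γ (F x) (G x)) → Equiv Γ (Exᵍ F) (Exᵍ G)
Exᵍ-equiv h = ¬-equiv (Π-equiv λ x → ¬-equiv (∧-equiv equiv-refl (h x)))

≈-equivˡ : ∀ {Γ x y z} → Γ ⊢ x ≈ y → Equiv Γ (x ≈ z) (y ≈ z)
≈-equivˡ p = deduce (≈-trans (wk₁ (≈-sym p)) top) , deduce (≈-trans (wk₁ p) top)

⟦⟧-equiv : ∀ {Γ n m} (t : Term n) (ρ : Fin n → Tup m) (π : Par m) (x : Tup m)
           (θ : Fin m → Tm) (r : Fin n → Tm) → (∀ i → Γ ⊢ θ (ρ i zero) ≈ r i) →
           Equiv Γ (⟪ ⟦ t ⟧ ρ π x ⟫ θ) (Val t r (θ (x zero)))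
⟦⟧-equiv (var i)  ρ π x θ r h = ≈-equivˡ (h i)
⟦⟧-equiv ε        ρ π x θ r h = equiv-refl
⟦⟧-equiv (s ⊢ₜ t) ρ π x θ r h = Exᵍ-equiv λ a → Exᵍ-equiv λ b → ∧-equiv
  (⟦⟧-equiv s _ _ _ (b ∷ a ∷ θ) r h) (∧-equiv (⟦⟧-equiv t _ _ _ (b ∷ a ∷ θ) r h) equiv-refl)
⟦⟧-equiv (s ∘ₜ t) ρ π x θ r h = Exᵍ-equiv λ a → Exᵍ-equiv λ b → ∧-equiv
  (⟦⟧-equiv s _ _ _ (b ∷ a ∷ θ) r h) (∧-equiv (⟦⟧-equiv t _ _ _ (b ∷ a ∷ θ) r h) equiv-refl)

tr-equiv : ∀ {Γ n m} (φ : Fm n) (ρ : Fin n → Tup m) (π : Par m)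
           (θ : Fin m → Tm) (r : Fin n → Tm) → (∀ i → Γ ⊢ θ (ρ i zero) ≈ r i) →
           Equiv Γ (⟪ tr φ ρ π ⟫ θ) (Tr φ r)
tr-equiv ⊥'      ρ π θ r h = equiv-refl
tr-equiv (s ≐ t) ρ π θ r h = Exᵍ-equiv λ a → Exᵍ-equiv λ b → ∧-equiv
  (⟦⟧-equiv s _ _ _ (b ∷ a ∷ θ) r h) (∧-equiv (⟦⟧-equiv t _ _ _ (b ∷ a ∷ θ) r h) equiv-refl)
tr-equiv (φ ⇒ ψ) ρ π θ r h = ⊃-equiv (tr-equiv φ ρ π θ r h) (tr-equiv ψ ρ π θ r h)
tr-equiv (∀' φ)  ρ π θ r h = Π-equiv λ x → ⊃-equiv equiv-refl
  (tr-equiv φ _ _ (x ∷ θ) (x ∷ r) λ { zero → ≈-refl ; (suc i) → h i })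

leibniz-equiv : ∀ {Γ n} (φ : Fm (suc n)) (ρ : Fin n → Tm) {x y} → Γ ⊢ x ≈ y →
                Equiv Γ (⟪ φ ⟫ (x ∷ ρ)) (⟪ φ ⟫ (y ∷ ρ))
leibniz-equiv φ ρ p = deduce (leibniz φ ρ (wk₁ p) top) , deduce (leibniz φ ρ (wk₁ (≈-sym p)) top)

-- Values of terms and substitution

code-resp : ∀ {Γ} v {x y} → Γ ⊢ x ≈ y → Γ ⊢ Code v x → Γ ⊢ Code v y
code-resp v = leibniz (renF (# 1 ∷ # 0 ∷ []) codeF) (v ∷ [])

Exᵍ₂E : ∀ {Γ C} {F : Tm → Tm → Pr} → Γ ⊢ Exᵍ (λ a → Exᵍ (F a)) →
        (∀ a b → Hyp (Good a ∧ Good b ∧ F a b) Γ → Good a ∧ Good b ∧ F a b ∷ₗ Γ ⊢ C) → Γ ⊢ C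
Exᵍ₂E h f = ∃E h λ a _ → ∃E (snd top) λ b _ →
  wk₁ (wk₁ (ƛ (f a b))) · (wk₁ (fst top) ,ᵖ top)

pair-functional : ∀ {Γ} a b x a' b' y →
                  Γ ⊢ Pair a b x ⊃ Pair a' b' y ⊃ a ≈ a' ⊃ b ≈ b' ⊃ x ≈ y
pair-functional a b x a' b' y = wk* (ƛ λ h → ƛ λ k → ƛ λ p → ƛ λ q →
  ∃E h λ v hv → ∃E k λ w kw →
    x      ≈⟨ snd hv ⟨
    a ▷ v  ≈⟨ ▷-cong p (code-injective v w b' · code-resp v q (fst hv) · fst kw) ⟩
    a' ▷ w ≈⟨ snd kw ⟩
    y      ∎)

val-functional : ∀ {Γ n} (t : Term n) r x y → Γ ⊢ Val t r x ⊃ Val t r y ⊃ x ≈ y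
val-functional (var i)  r x y = wk* (ƛ λ h → ƛ λ k → ≈-trans (≈-sym h) k)
val-functional ε        r x y = wk* (ƛ λ h → ƛ λ k → ≈-trans h (≈-sym k))
val-functional (s ⊢ₜ t) r x y = wk* (ƛ λ h → ƛ λ k →
  Exᵍ₂E h λ a b f → Exᵍ₂E k λ a' b' g → let f' = snd (snd f) ; g' = snd (snd g) in
  pair-functional a b x a' b' y · snd (snd f') · snd (snd g')
    · (val-functional s r a a' · fst f' · fst g')
    · (val-functional t r b b' · fst (snd f') · fst (snd g')))
val-functional (s ∘ₜ t) r x y = wk* (ƛ λ h → ƛ λ k →
  Exᵍ₂E h λ a b f → Exᵍ₂E k λ a' b' g →
    x       ≈⟨ snd (snd (snd (snd f))) ⟨
    a ∙ b   ≈⟨ ∙-cong (val-functional s r a a' · fst (snd (snd f)) · fst (snd (snd g)))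
                      (val-functional t r b b' · fst (snd (snd (snd f))) · fst (snd (snd (snd g)))) ⟩
    a' ∙ b' ≈⟨ snd (snd (snd (snd g))) ⟩
    y       ∎)

val-resp : ∀ {Γ n} (t : Term n) r {x y} → Γ ⊢ x ≈ y → Equiv Γ (Val t r x) (Val t r y)
val-resp (var i)  r p = leibniz-equiv (var (# 1) ≐ var (# 0)) (r i ∷ []) p
val-resp ε        r p = ≈-equivˡ p
val-resp (s ⊢ₜ t) r p = Exᵍ-equiv λ a → Exᵍ-equiv λ b → ∧-equiv equiv-refl (∧-equiv equiv-refl
  (leibniz-equiv (renF (# 1 ∷ # 2 ∷ # 0 ∷ []) pairF) (a ∷ b ∷ []) p))
val-resp (s ∘ₜ t) r p = Exᵍ-equiv λ a → Exᵍ-equiv λ b → ∧-equiv equiv-refl (∧-equiv equiv-refl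
  (leibniz-equiv (var (# 1) ∘ₜ var (# 2) ≐ var (# 0)) (a ∷ b ∷ []) p))

-- Compound terms denote compound terms of Seq, which lets translated equations be exchanged for
-- plain ones by `tr-≐`.
record Denotes (Γ : List Pr) {n} (t : Term n) (r : Fin n → Tm) (a : Tm) : Set where
  constructor denotes
  field
    good  : Γ ⊢ Good a
    value : Γ ⊢ Val t r a
open Denotes

denotes-var : ∀ {Γ n} (r : Fin n → Tm) i → Γ ⊢ Good (r i) → Denotes Γ (var i) r (r i)
denotes-var r i g = denotes g ≈-refl

denotes-ε : ∀ {Γ n} (r : Fin n → Tm) → Denotes Γ ε r e
denotes-ε r = denotes good-e ≈-refl

denotes-∙ : ∀ {Γ n} {s t : Term n} {r a b} →
            Denotes Γ s r a → Denotes Γ t r b → Denotes Γ (s ∘ₜ t) r (a ∙ b)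
denotes-∙ {a = a} {b} h k = denotes (good-∙ a b · good h · good k)
  (∃I a (good h ,ᵖ ∃I b (good k ,ᵖ value h ,ᵖ value k ,ᵖ ≈-refl)))

denotes-▷ : ∀ {Γ n} {s t : Term n} {r a b} v →
            Denotes Γ s r a → Denotes Γ t r b → Γ ⊢ Code v b → Denotes Γ (s ⊢ₜ t) r (a ▷ v)
denotes-▷ {a = a} {b} v h k c = denotes (good-▷ a v · good h)
  (∃I a (good h ,ᵖ ∃I b (good k ,ᵖ value h ,ᵖ value k ,ᵖ ∃I v (c ,ᵖ ≈-refl))))

val-total : ∀ {Γ n} (t : Term n) r → (∀ i → Γ ⊢ Good (r i)) → Γ ⊢ Exᵍ (Val t r)
val-total (var i)  r g = ∃I (r i) (g i ,ᵖ ≈-refl)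
val-total ε        r g = ∃I e (good-e ,ᵖ ≈-refl)
val-total (s ⊢ₜ t) r g = wk* (ƛ λ h → ƛ λ k → ∃E h λ a ha → ∃E k λ b kb →
  ∃E (code-surjective b · fst kb) λ v c →
    let d = denotes-▷ {s = s} {t} v (denotes (fst ha) (snd ha)) (denotes (fst kb) (snd kb)) c
    in ∃I (a ▷ v) (good d ,ᵖ value d))
  · val-total s r g · val-total t r g
val-total (s ∘ₜ t) r g = wk* (ƛ λ h → ƛ λ k → ∃E h λ a ha → ∃E k λ b kb →
    let d = denotes-∙ {s = s} {t} (denotes (fst ha) (snd ha)) (denotes (fst kb) (snd kb))
    in ∃I (a ∙ b) (good d ,ᵖ value d))
  · val-total s r g · val-total t r g

-- Substitution becomes evaluation at the values `r'` of the substituted terms. The variable case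
-- rests on values being unique.
val-sub : ∀ {Γ n m} (t : Term n) (σ : Fin n → Term m) r' r → (∀ i → Γ ⊢ Val (σ i) r (r' i)) →
          ∀ x → Equiv Γ (Val t r' x) (Val (subT σ t) r x)
val-sub (var i)  σ r' r h x =
    deduce (proj₁ (val-resp (σ i) r top) · wk₁ (h i))
  , deduce (val-functional (σ i) r (r' i) x · wk₁ (h i) · top)
val-sub ε        σ r' r h x = equiv-refl
val-sub (s ⊢ₜ t) σ r' r h x = Exᵍ-equiv λ a → Exᵍ-equiv λ b →
  ∧-equiv (val-sub s σ r' r h a) (∧-equiv (val-sub t σ r' r h b) equiv-refl)
val-sub (s ∘ₜ t) σ r' r h x = Exᵍ-equiv λ a → Exᵍ-equiv λ b →
  ∧-equiv (val-sub s σ r' r h a) (∧-equiv (val-sub t σ r' r h b) equiv-refl)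

val-wk : ∀ {Γ n} (t : Term n) r x {y} → Γ ⊢ Val t r y → Γ ⊢ Val (renT suc t) (x ∷ r) y
val-wk {Γ} t r x {y} h = subst (λ s → Γ ⊢ Val s (x ∷ r) y) (sym (renT≡subT suc t))
  (proj₁ (val-sub t (var ∘ suc) r (x ∷ r) (λ i → ≈-refl) y) · h)

tr-sub : ∀ {Γ n m} (φ : Fm n) (σ : Fin n → Term m) r' r → (∀ i → Γ ⊢ Val (σ i) r (r' i)) →
         Equiv Γ (Tr φ r') (Tr (subF σ φ) r)
tr-sub ⊥'      σ r' r h = equiv-refl
tr-sub (s ≐ t) σ r' r h = Exᵍ-equiv λ a → Exᵍ-equiv λ b →
  ∧-equiv (val-sub s σ r' r h a) (∧-equiv (val-sub t σ r' r h b) equiv-refl)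
tr-sub (φ ⇒ ψ) σ r' r h = ⊃-equiv (tr-sub φ σ r' r h) (tr-sub ψ σ r' r h)
tr-sub (∀' φ)  σ r' r h = Π-equiv λ x → ⊃-equiv equiv-refl
  (tr-sub φ (liftSub σ) (x ∷ r') (x ∷ r) λ
    { zero → ≈-refl ; (suc i) → val-wk (σ i) r x (h i) })

tr-ren : ∀ {Γ n m} (φ : Fm n) (f : Fin n → Fin m) r' r → (∀ i → Γ ⊢ r (f i) ≈ r' i) →
         Equiv Γ (Tr φ r') (Tr (renF f φ) r)
tr-ren {Γ} φ f r' r h = subst (λ ψ → Equiv Γ (Tr φ r') (Tr ψ r)) (sym (renF≡subF f φ))
  (tr-sub φ (var ∘ f) r' r h)

-- The existential witnesses in a translated equation are unique, so they may be replaced by the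
-- known denotations.
tr-≐ : ∀ {Γ n} {s t : Term n} {r a b} → Denotes Γ s r a → Denotes Γ t r b →
       Equiv Γ (Tr (s ≐ t) r) (a ≈ b)
tr-≐ {s = s} {t} {r} {a} {b} h k =
    wk* (ƛ λ h → ƛ λ k → ƛ λ p → Exᵍ₂E p λ a' b' q → let q' = snd (snd q) in
      a  ≈⟨ val-functional s r a a' · h · fst q' ⟩
      a' ≈⟨ snd (snd q') ⟩
      b' ≈⟨ val-functional t r b' b · fst (snd q') · k ⟩
      b  ∎) · value h · value k
  , deduce (∃I a (wk₁ (good h) ,ᵖ ∃I b (wk₁ (good k) ,ᵖ wk₁ (value h) ,ᵖ wk₁ (value k) ,ᵖ top)))

-- An object-level ∃ is translated through its abbreviation by ∀ and ¬, so the result is this form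
-- and not `Exᵍ`.
tr-∃I : ∀ {Γ} {F : Tm → Pr} u → Γ ⊢ Good u → Γ ⊢ F u → Γ ⊢ ¬ Πᵍ λ u → ¬ F u
tr-∃I u g h = deduce (top $$ u · wk₁ g · wk₁ h)

tr-∃E : ∀ {Γ C} {F : Tm → Pr} → Γ ⊢ ¬ (Πᵍ λ u → ¬ F u) →
        (∀ u → Hyp (Good u ∧ F u) Γ → Good u ∧ F u ∷ₗ Γ ⊢ C) → Γ ⊢ C
tr-∃E h f = stable (deduce (wk₁ h · Λ λ u → deduce (deduce
  (wk₁ (wk₁ top) · (wk₁ (wk₁ (wk₁ (ƛ (f u)))) · (wk₁ top ,ᵖ top))))))

-- The translated axioms hold in the cut

overlap-equiv : ∀ {Γ} x y z w u →
  Γ ⊢ Good x → Γ ⊢ Good y → Γ ⊢ Good z → Γ ⊢ Good w → Γ ⊢ Good u →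
  Equiv Γ (Tr {5} ((var (# 2) ≐ var (# 4) ∘ₜ var (# 0) ∧' var (# 0) ∘ₜ var (# 1) ≐ var (# 3))
                ∨' (var (# 4) ≐ var (# 2) ∘ₜ var (# 0) ∧' var (# 0) ∘ₜ var (# 3) ≐ var (# 1)))
              (u ∷ w ∷ z ∷ y ∷ x ∷ []))
          (Overlapˡ x y z w u ∨ Overlapʳ x y z w u)
overlap-equiv {Γ} x y z w u gx gy gz gw gu = ∨-equiv
  (∧-equiv (tr-≐ dz (denotes-∙ dx du)) (tr-≐ (denotes-∙ du dw) dy))
  (∧-equiv (tr-≐ dx (denotes-∙ dz du)) (tr-≐ (denotes-∙ du dy) dw))
  where
  r : Fin 5 → Tm
  r = u ∷ w ∷ z ∷ y ∷ x ∷ []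
  du : Denotes Γ (var (# 0)) r u
  du = denotes-var r (# 0) gu
  dw : Denotes Γ (var (# 1)) r w
  dw = denotes-var r (# 1) gw
  dz : Denotes Γ (var (# 2)) r z
  dz = denotes-var r (# 2) gz
  dy : Denotes Γ (var (# 3)) r y
  dy = denotes-var r (# 3) gy
  dx : Denotes Γ (var (# 4)) r x
  dx = denotes-var r (# 4) gx

sound-axiom : ∀ {A Γ} → Seq⁺ A → Γ ⊢ Tr A []
sound-axiom (base seq₁) = wk* (Λ λ x → ƛ λ gx → Λ λ y → ƛ λ gy → ƛ λ p →
  let r = y ∷ x ∷ [] in
  ∃E (code-surjective y · gy) λ v c →
    ▷≉e (proj₁ (tr-≐
      (denotes-▷ v (denotes-var r (# 1) gx) (denotes-var r (# 0) gy) c) (denotes-ε r)) · p))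
sound-axiom (base seq₂) = wk* (
  Λ λ x → ƛ λ gx → Λ λ y → ƛ λ gy → Λ λ x' → ƛ λ gx' → Λ λ y' → ƛ λ gy' → ƛ λ p →
  let r = y' ∷ x' ∷ y ∷ x ∷ [] in
  ∃E (code-surjective y · gy) λ v c → ∃E (code-surjective y' · gy') λ v' c' →
  ƛ (λ q →
    proj₂ (tr-≐ (denotes-var r (# 3) gx) (denotes-var r (# 1) gx')) · ▷-injˡ q
    ,ᵖ proj₂ (tr-≐ (denotes-var r (# 2) gy) (denotes-var r (# 0) gy'))
      -- The equal stored entries have equal images, which are `y` and `y'`.
      · (code-functional v' y y' · leibniz codeF (y ∷ []) (▷-injʳ q) c · c'))
  · (proj₁ (tr-≐ (denotes-▷ v (denotes-var r (# 3) gx) (denotes-var r (# 2) gy) c)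
                 (denotes-▷ v' (denotes-var r (# 1) gx') (denotes-var r (# 0) gy') c')) · p))
sound-axiom (base seq₃) = wk* (Λ λ x → ƛ λ gx →
  let r = x ∷ [] in
  proj₂ (tr-≐ (denotes-∙ (denotes-var r (# 0) gx) (denotes-ε r)) (denotes-var r (# 0) gx)) · ∙-e x)
sound-axiom (base seq₄) = wk* (Λ λ x → ƛ λ gx → Λ λ y → ƛ λ gy → Λ λ z → ƛ λ gz →
  let r = z ∷ y ∷ x ∷ [] in
  -- One preimage of `z` serves on both sides, and the axiom reduces to its original.
  ∃E (code-surjective z · gz) λ v c → proj₂ (tr-≐
    (denotes-∙ (denotes-var r (# 2) gx) (denotes-▷ v (denotes-var r (# 1) gy) (denotes-var r (# 0) gz) c))
    (denotes-▷ v (denotes-∙ (denotes-var r (# 2) gx) (denotes-var r (# 1) gy)) (denotes-var r (# 0) gz) c))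
  · ∙-▷ x y v)
sound-axiom (base seq₅) = wk* (Λ λ x → ƛ λ gx → case-e▷ x
  (λ p → let r = x ∷ [] in inl (proj₂ (tr-≐ (denotes-var r (# 0) gx) (denotes-ε r)) · p))
  -- The entry `v` may lie outside the cut; its image `z` under the bijection represents it there.
  (λ y v p → ƛ (λ gy → ∃E (code-total v) λ z h →
      let r = z ∷ y ∷ x ∷ [] in
      inr (tr-∃I y gy (tr-∃I z (fst h) (proj₂ (tr-≐ (denotes-var r (# 2) gx)
        (denotes-▷ v (denotes-var r (# 1) gy) (denotes-var r (# 0) (fst h)) (snd h))) · p))))
    · (good-▷⁻¹ y v · respects goodF p gx)))
sound-axiom seq*₃ = wk* (Λ λ x → ƛ λ gx →
  let r = x ∷ [] in
  proj₂ (tr-≐ (denotes-∙ (denotes-var r (# 0) gx) (denotes-ε r)) (denotes-var r (# 0) gx)) · ∙-e x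
  ,ᵖ proj₂ (tr-≐ (denotes-∙ (denotes-ε r) (denotes-var r (# 0) gx)) (denotes-var r (# 0) gx))
    · good-unitˡ gx)
sound-axiom seq*₅ = wk* (
  Λ λ x → ƛ λ gx → Λ λ y → ƛ λ gy → Λ λ z → ƛ λ gz → Λ λ w → ƛ λ gw →
  let r = w ∷ z ∷ y ∷ x ∷ [] in
  (ƛ λ p → edit {x = x} {y} {z} {w} (snd (fst gy)) (fst (fst gw))
    (proj₁ (tr-≐ (denotes-∙ (denotes-var r (# 3) gx) (denotes-var r (# 2) gy))
                 (denotes-∙ (denotes-var r (# 1) gz) (denotes-var r (# 0) gw))) · p)
    (λ u h → ƛ (λ gu → tr-∃I u gu (proj₂ (overlap-equiv x y z w u gx gy gz gw gu) · inl h))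
      -- The overlap is good, being a prefix of the good `y` with good remainder `w`.
      · (good-prefix u w · respects goodF (≈-sym (snd h)) gy · gw))
    (λ u h → ƛ (λ gu → tr-∃I u gu (proj₂ (overlap-equiv x y z w u gx gy gz gw gu) · inr h))
      · (good-prefix u y · respects goodF (≈-sym (snd h)) gw · gy)))
  ,ᵖ
  (ƛ λ p → proj₂ (tr-≐ (denotes-∙ (denotes-var r (# 3) gx) (denotes-var r (# 2) gy))
                       (denotes-∙ (denotes-var r (# 1) gz) (denotes-var r (# 0) gw)))
    · tr-∃E p λ u h → ∨E (proj₁ (overlap-equiv x y z w u gx gy gz gw (fst h)) · snd h)
        (λ k →
          x ∙ y       ≈⟨ ∙-cong ≈-refl (snd k) ⟨
          x ∙ (u ∙ w) ≈⟨ assoc x u (fst (fst gw)) ⟩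
          x ∙ u ∙ w   ≈⟨ ∙-cong (fst k) ≈-refl ⟨
          z ∙ w       ∎)
        (λ k →
          x ∙ y       ≈⟨ ∙-cong (fst k) ≈-refl ⟩
          z ∙ u ∙ y   ≈⟨ assoc z u (fst (fst gy)) ⟨
          z ∙ (u ∙ y) ≈⟨ ∙-cong ≈-refl (snd k) ⟩
          z ∙ w       ∎)))
sound-axiom seq⁺c = wk* (Λ λ x → ƛ λ gx → Λ λ y → ƛ λ gy → Λ λ z → ƛ λ gz → ƛ λ p →
  let r = z ∷ y ∷ x ∷ [] in
  proj₂ (tr-≐ (denotes-var r (# 1) gy) (denotes-var r (# 0) gz)) · ∨E p
    (λ h → good-cancelˡ x y z · gx · gy · gz
      · (proj₁ (tr-≐ (denotes-∙ (denotes-var r (# 2) gx) (denotes-var r (# 1) gy))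
                     (denotes-∙ (denotes-var r (# 2) gx) (denotes-var r (# 0) gz))) · h))
    (λ h → good-cancelʳ gx
      (proj₁ (tr-≐ (denotes-∙ (denotes-var r (# 1) gy) (denotes-var r (# 2) gx))
                   (denotes-∙ (denotes-var r (# 0) gz) (denotes-var r (# 2) gx))) · h)))

-- Soundness of derivations under the translation

sound : ∀ {Γ n} {φ : Fm n} → Prf Seq⁺ φ → (r : Fin n → Tm) → (∀ i → Γ ⊢ Good (r i)) → Γ ⊢ Tr φ r
sound (axiom {A = A} a) r g = proj₁ (tr-ren A (λ ()) [] r λ ()) · sound-axiom a
sound K                 r g = deduce (deduce (wk₁ top))
sound S                 r g = deduce (deduce (deduce
  (wk₁ (wk₁ top) · top · (wk₁ top · top))))
sound DNE               r g = deduce (stable top)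
sound (MP p q)          r g = sound p r g · sound q r g
sound (Gen p)           r g = Λ λ x → deduce (sound p (x ∷ r) λ
  { zero → top ; (suc i) → wk₁ (g i) })
-- A term has a good value, and the relativised quantifier is instantiated there.
sound (Inst {φ = φ} t)  r g = deduce (∃E (wk₁ (val-total t r g)) λ x _ →
  proj₁ (tr-sub φ (t ∷ var) (x ∷ r) r λ { zero → snd top ; (suc i) → ≈-refl })
  · (wk₁ top $$ x · fst top))
sound (∀Dist {φ = φ})   r g = deduce (deduce (Λ λ x → deduce
  (wk₁ (wk₁ top) $$ x · top · (proj₁ (tr-ren φ suc r (x ∷ r) λ i → ≈-refl) · wk₁ top))))
sound (Refl t)          r g = ∃E (val-total t r g) λ x _ →
  ∃I x (fst top ,ᵖ ∃I x (fst top ,ᵖ snd top ,ᵖ snd top ,ᵖ ≈-refl))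
-- The two values `a` and `b` agree, so `b` is a value of both terms and `φ` is evaluated at `b` on
-- both sides.
sound (Leib φ s t)      r g = deduce (deduce (Exᵍ₂E (wk₁ top) λ a b _ →
  proj₁ (tr-sub φ (t ∷ var) (b ∷ r) r λ
    { zero → fst (snd (snd (snd top))) ; (suc i) → ≈-refl })
  · (proj₂ (tr-sub φ (s ∷ var) (b ∷ r) r λ
      { zero → proj₁ (val-resp s r (snd (snd (snd (snd top))))) · fst (snd (snd top))
      ; (suc i) → ≈-refl })
    · wk₁ top)))

theorem6 : Seq Interprets Seq⁺
theorem6 = cut , record
  -- The combinator S K K proves the trivial parameter condition.
  { params-exist = MP (MP S K) (K {ψ = ⊥'})
  ; preserves    = λ A p → ⊢-closed ((⊥' ⇒ ⊥') ⇒ tr₀ A) (deduce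
      (proj₂ (tr-equiv A (λ ()) id [] [] λ ()) · sound p [] λ ()))
  }
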